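{- There exists an algorithm that takes as input a graph $G$, a finite family $\mathcal{H}=\{H_j\}_{j\in J}$ of connected nonnull subgraphs of $G$, and a tree decomposition $\mathcal{T}=(T,\{X_t\}_{t\in V(T)})$ of $G$, and computes in time $$\mathcal{O}\Big(|J|\cdot\big((|J|+|V(T)|)\cdot|V(G)|+|E(G)|\big)\Big)$$ the graph $G(\mathcal{H})$ and a tree decomposition $\mathcal{T}'=(T,\{X'_t\}_{t\in V(T)})$ of $G(\mathcal{H})$ (with the same tree $T$) such that $\alpha(\mathcal{T}')\le\alpha(\mathcal{T})$.
   Context: All graphs are finite, simple, and undirected; a graph is nonnull if it has at least one vertex. For a graph $G$ and a family $\mathcal{H}=\{H_j\}_{j\in J}$ of connected subgraphs of $G$, the graph $G(\mathcal{H})$ has vertex set $J$, and two distinct elements $i,j\in J$ are adjacent if and only if $H_i$ and $H_j$ have a vertex in common or there is an edge of $G$ with one endpoint in $H_i$ and the other in $H_j$. A tree decomposition of a graph $G$ is a pair $\mathcal{T}=(T,\{X_t\}_{t\in V(T)})$ where $T$ is a tree and each node $t$ is assigned a bag $X_t\subseteq V(G)$ such that every vertex of $G$ is in at least one bag, every edge of $G$ has both endpoints in some common bag, and for every $u\in V(G)$ the subgraph of $T$ induced by $\{t: u\in X_t\}$ is connected. The independence number of a tree decomposition $\mathcal{T}$ of $G$ is $\alpha(\mathcal{T})=\max_{t\in V(T)}\alpha(G[X_t])$, where $\alpha(H)$ is the maximum size of an independent set in $H$. -}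

module Defs where

open import Data.Bool using (if_then_else_)
open import Data.Fin using (Fin; zero; suc; toℕ; fromℕ; inject₁; _<?_)
open import Data.Fin.Properties using (any?; all?) renaming (_≟_ to _≟ᶠ_)
open import Data.Fin.Subset using (Subset; inside; outside; _∈_; _⊆_; ∣_∣; ⊤)
open import Data.Fin.Subset.Properties using (_∈?_; _⊆?_)
open import Data.List using (List; []; _∷_; _++_; map; concat; concatMap; filter; length; lookup; allFin; cartesianProduct)
open import Data.List.Extrema.Nat using (max)
open import Data.List.Relation.Unary.Unique.Propositional using (Unique)
import Data.List.Membership.Propositional as List
open import Data.Nat using (ℕ; zero; suc; _+_; _∸_; _≡ᵇ_; NonZero)
open import Data.Product using (_×_; _,_; ∃-syntax; proj₁; proj₂)
open import Data.Sum using (_⊎_; inj₁; inj₂)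
import Data.Vec as Vec
open import Function using (_∘_)
open import Function.Definitions using (Injective)
open import Relation.Binary.Construct.Closure.ReflexiveTransitive using (Star)
open import Relation.Binary.PropositionalEquality using (_≡_; _≢_; sym)
open import Relation.Nullary using (¬_; Dec)
open import Relation.Nullary.Decidable using (_×-dec_; _⊎-dec_; _→-dec_; ¬?)

------------------------------------------------------------------------
-- Graphs

record Graph (n : ℕ) : Set₁ where
  infix 4 _∼_ _∼?_
  field
    _∼_      : Fin n → Fin n → Set
    _∼?_     : ∀ u v → Dec (u ∼ v)
    ∼-sym    : ∀ {u v} → u ∼ v → v ∼ u
    ∼-irrefl : ∀ {v} → ¬ v ∼ v

∣E∣ : ∀ {n} → Graph n → ℕ
∣E∣ {n} G = length (filter (λ (u , v) → (u <? v) ×-dec (u ∼? v)) (cartesianProduct (allFin n) (allFin n)))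
  where open Graph G

record Subgraph {n} (G : Graph n) : Set₁ where
  infix 4 _~_ _~?_
  field
    V     : Subset n
    _~_   : Fin n → Fin n → Set
    _~?_  : ∀ u v → Dec (u ~ v)
    ~-sym : ∀ {u v} → u ~ v → v ~ u
    ~⇒∼   : ∀ {u v} → u ~ v → Graph._∼_ G u v
    ~⇒∈V  : ∀ {u v} → u ~ v → u ∈ V

induced : ∀ {n} (G : Graph n) → Subset n → Subgraph G
induced G X = record
  { V     = X
  ; _~_   = λ u v → u ∈ X × v ∈ X × u ∼ v
  ; _~?_  = λ u v → (u ∈? X) ×-dec ((v ∈? X) ×-dec (u ∼? v))
  ; ~-sym = λ (u∈ , v∈ , e) → v∈ , u∈ , ∼-sym e
  ; ~⇒∼   = λ (_ , _ , e) → e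
  ; ~⇒∈V  = proj₁
  }
  where open Graph G

-- The null subgraph counts as connected; nonnullness is always a separate
-- condition.
Connected : ∀ {n} {G : Graph n} → Subgraph G → Set
Connected H = ∀ {u v} → u ∈ V → v ∈ V → Star _~_ u v
  where open Subgraph H

record Cycle {n} (G : Graph n) : Set where
  open Graph G
  field
    {k}      : ℕ
    vertex   : Fin (3 + k) → Fin n
    distinct : Injective _≡_ _≡_ vertex
    step     : ∀ (i : Fin (2 + k)) → vertex (inject₁ i) ∼ vertex (suc i)
    close    : vertex (fromℕ (2 + k)) ∼ vertex zero

record IsTree {n} (T : Graph n) : Set where
  field
    nonnull   : NonZero n
    connected : Connected (induced T ⊤)
    acyclic   : ¬ Cycle T

-- The graph G(𝓗).
infix 8 _⟨_⟩
_⟨_⟩ : ∀ {n k} (G : Graph n) → (Fin k → Subgraph G) → Graph k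
G ⟨ H ⟩ = record
  { _∼_      = λ i j → i ≢ j × Touch i j
  ; _∼?_     = λ i j → ¬? (i ≟ᶠ j) ×-dec
                 (any? (λ v → (v ∈? V (H i)) ×-dec (v ∈? V (H j)))
                  ⊎-dec any? (λ u → any? (λ v → (u ∈? V (H i)) ×-dec ((v ∈? V (H j)) ×-dec (u ∼? v)))))
  ; ∼-sym    = λ (i≢j , t) → i≢j ∘ sym , Touch-sym t
  ; ∼-irrefl = λ (i≢i , _) → i≢i _≡_.refl
  }
  where
  open Graph G
  open Subgraph using (V)

  Touch : _ → _ → Set
  Touch i j = (∃[ v ] v ∈ V (H i) × v ∈ V (H j))
            ⊎ (∃[ u ] ∃[ v ] u ∈ V (H i) × v ∈ V (H j) × u ∼ v)

  Touch-sym : ∀ {i j} → Touch i j → Touch j i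
  Touch-sym (inj₁ (v , v∈i , v∈j))         = inj₁ (v , v∈j , v∈i)
  Touch-sym (inj₂ (u , v , u∈i , v∈j , e)) = inj₂ (v , u , v∈j , u∈i , ∼-sym e)

------------------------------------------------------------------------
-- Independence number

Independent : ∀ {n} {G : Graph n} → Subgraph G → Subset n → Set
Independent H S = S ⊆ V × (∀ u v → u ∈ S → v ∈ S → ¬ u ~ v)
  where open Subgraph H

independent? : ∀ {n} {G : Graph n} (H : Subgraph G) S → Dec (Independent H S)
independent? H S = (S ⊆? V) ×-dec
  all? (λ u → all? (λ v → (u ∈? S) →-dec ((v ∈? S) →-dec ¬? (u ~? v))))
  where open Subgraph H

subsets : ∀ n → List (Subset n)
subsets zero    = Vec.[] ∷ []
subsets (suc n) = map (outside Vec.∷_) (subsets n) ++ map (inside Vec.∷_) (subsets n)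

α : ∀ {n} {G : Graph n} → Subgraph G → ℕ
α H = max 0 (map ∣_∣ (filter (independent? H) (subsets _)))

------------------------------------------------------------------------
-- Tree decompositions

record IsTreeDecomposition {n p} (G : Graph n) (T : Graph p) (X : Fin p → Subset n) : Set where
  open Graph G
  field
    isTree         : IsTree T
    vertex-covered : ∀ u → ∃[ t ] u ∈ X t
    edge-covered   : ∀ {u v} → u ∼ v → ∃[ t ] (u ∈ X t × v ∈ X t)
    -- The second argument of induced is the set { t | u ∈ X t }.
    connected      : ∀ u → Connected (induced T (Vec.tabulate (λ t → Vec.lookup (X t) u)))

α-bags : ∀ {n p} (G : Graph n) (X : Fin p → Subset n) → ℕ
α-bags {p = p} G X = max 0 (map (λ t → α (induced G (X t))) (allFin p))

------------------------------------------------------------------------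
-- Model of computation: structured programs for a unit-cost RAM with
-- addition and truncated subtraction.  The memory consists of registers and
-- of arrays; a program mentions only finitely many of each, the names being
-- literal, so that it could be run in a single linear memory at the price of
-- a constant factor.

record State : Set where
  constructor state
  field
    reg : ℕ → ℕ
    arr : ℕ → ℕ → ℕ
open State public

infixl 6 _⊕_ _⊖_
data Exp : Set where
  lit     : ℕ → Exp
  var     : ℕ → Exp
  read    : ℕ → Exp → Exp
  _⊕_ _⊖_ : Exp → Exp → Exp

infixr 4 _﹔_
infix  5 _≔_ _[_]≔_
data Cmd : Set where
  skip          : Cmd
  _≔_           : ℕ → Exp → Cmd
  _[_]≔_        : ℕ → Exp → Exp → Cmd
  _﹔_           : Cmd → Cmd → Cmd
  ifnz          : Exp → Cmd → Cmd → Cmd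
  whilenz       : Exp → Cmd → Cmd

⟦_⟧ : Exp → State → ℕ
⟦ lit m    ⟧ σ = m
⟦ var x    ⟧ σ = reg σ x
⟦ read a e ⟧ σ = arr σ a (⟦ e ⟧ σ)
⟦ e ⊕ f    ⟧ σ = ⟦ e ⟧ σ + ⟦ f ⟧ σ
⟦ e ⊖ f    ⟧ σ = ⟦ e ⟧ σ ∸ ⟦ f ⟧ σ

cost : Exp → ℕ
cost (lit _)    = 1
cost (var _)    = 1
cost (read _ e) = 1 + cost e
cost (e ⊕ f)    = 1 + cost e + cost f
cost (e ⊖ f)    = 1 + cost e + cost f

update : ∀ {A : Set} → (ℕ → A) → ℕ → A → ℕ → A
update f x a y = if x ≡ᵇ y then a else f y

setReg : ℕ → ℕ → State → State
setReg x m σ = state (update (reg σ) x m) (arr σ)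

setArr : ℕ → ℕ → ℕ → State → State
setArr a i m σ = state (reg σ) (update (arr σ) a (update (arr σ a) i m))

-- ⟨ c , σ ⟩⇓⟨ σ′ , τ ⟩ : started in σ, the program c halts in σ′ after τ steps.
infix 3 ⟨_,_⟩⇓⟨_,_⟩
data ⟨_,_⟩⇓⟨_,_⟩ : Cmd → State → State → ℕ → Set where
  ⇓skip : ∀ {σ} → ⟨ skip , σ ⟩⇓⟨ σ , 1 ⟩
  ⇓reg  : ∀ {σ x e} →
    ⟨ x ≔ e , σ ⟩⇓⟨ setReg x (⟦ e ⟧ σ) σ , 1 + cost e ⟩
  ⇓arr  : ∀ {σ a e f} →
    ⟨ a [ e ]≔ f , σ ⟩⇓⟨ setArr a (⟦ e ⟧ σ) (⟦ f ⟧ σ) σ , 1 + cost e + cost f ⟩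
  ⇓seq  : ∀ {σ₁ σ₂ σ₃ c d τ₁ τ₂} →
    ⟨ c , σ₁ ⟩⇓⟨ σ₂ , τ₁ ⟩ → ⟨ d , σ₂ ⟩⇓⟨ σ₃ , τ₂ ⟩ →
    ⟨ c ﹔ d , σ₁ ⟩⇓⟨ σ₃ , τ₁ + τ₂ ⟩
  ⇓then : ∀ {σ₁ σ₂ e c d τ} → ⟦ e ⟧ σ₁ ≢ 0 →
    ⟨ c , σ₁ ⟩⇓⟨ σ₂ , τ ⟩ →
    ⟨ ifnz e c d , σ₁ ⟩⇓⟨ σ₂ , 1 + cost e + τ ⟩
  ⇓else : ∀ {σ₁ σ₂ e c d τ} → ⟦ e ⟧ σ₁ ≡ 0 →
    ⟨ d , σ₁ ⟩⇓⟨ σ₂ , τ ⟩ →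
    ⟨ ifnz e c d , σ₁ ⟩⇓⟨ σ₂ , 1 + cost e + τ ⟩
  ⇓done : ∀ {σ e c} → ⟦ e ⟧ σ ≡ 0 →
    ⟨ whilenz e c , σ ⟩⇓⟨ σ , 1 + cost e ⟩
  ⇓loop : ∀ {σ₁ σ₂ σ₃ e c τ₁ τ₂} → ⟦ e ⟧ σ₁ ≢ 0 →
    ⟨ c , σ₁ ⟩⇓⟨ σ₂ , τ₁ ⟩ → ⟨ whilenz e c , σ₂ ⟩⇓⟨ σ₃ , τ₂ ⟩ →
    ⟨ whilenz e c , σ₁ ⟩⇓⟨ σ₃ , 1 + cost e + τ₁ + τ₂ ⟩

------------------------------------------------------------------------
-- Representation of sets and graphs by lists, in arbitrary order and without
-- repetition

record Listing {n} (P : Fin n → Set) : Set where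
  field
    elems    : List (Fin n)
    unique   : Unique elems
    sound    : ∀ {x} → x List.∈ elems → P x
    complete : ∀ {x} → P x → x List.∈ elems
open Listing public using (elems)

AdjacencyLists : ∀ {n} → Graph n → Set
AdjacencyLists G = ∀ v → Listing (v ∼_)
  where open Graph G

record SubgraphLists {n} {G : Graph n} (H : Subgraph G) : Set where
  open Subgraph H
  field
    vertices   : Listing (_∈ V)
    neighbours : ∀ v → Listing (v ~_)

BagLists : ∀ {n p} → (Fin p → Subset n) → Set
BagLists X = ∀ t → Listing (_∈ X t)

rows : ∀ {m n} {P : Fin m → Fin n → Set} → (∀ i → Listing (P i)) → List (List ℕ)
rows ℓ = map (λ i → map toℕ (elems (ℓ i))) (allFin _)

------------------------------------------------------------------------
-- Memory layout.  A list of lists xss is stored as the array concat xss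
-- together with the array offsets 0 xss of length 1 + length xss: the i-th
-- list occupies the positions from offset i (included) to offset i + 1
-- (excluded).

offsets : ℕ → List (List ℕ) → List ℕ
offsets o []         = o ∷ []
offsets o (xs ∷ xss) = o ∷ offsets (o + length xs) xss

-- An array (or register file) that starts with the given list and is zero
-- elsewhere.
array : List ℕ → ℕ → ℕ
array []       _       = 0
array (x ∷ xs) zero    = x
array (x ∷ xs) (suc i) = array xs i

pattern G-offset  = 0
pattern G-nbr     = 1
pattern T-offset  = 2
pattern T-nbr     = 3
pattern X-offset  = 4
pattern X-elem    = 5
pattern H-offset  = 6
pattern H-vertex  = 7
pattern HE-offset = 8
pattern HE-nbr    = 9
pattern GH-offset = 10
pattern GH-nbr    = 11
pattern X′-offset = 12
pattern X′-elem   = 13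

-- Registers 0, 1, 2 hold |V(G)|, |J|, |V(T)|.  The lists stored in HE are the
-- neighbourhoods in H j of the vertices of H j, in the order in which these
-- vertices occur in H-vertex.
input : ∀ {n k p} (G : Graph n) (H : Fin k → Subgraph G) (T : Graph p) (X : Fin p → Subset n) →
  AdjacencyLists G → (∀ j → SubgraphLists (H j)) → AdjacencyLists T → BagLists X → State
input {n} {k} {p} G H T X g h t x = state (array (n ∷ k ∷ p ∷ [])) memory
  where
  open SubgraphLists

  neighbourhoods : List (List ℕ)
  neighbourhoods = concatMap (λ j → map (λ v → map toℕ (elems (neighbours (h j) v))) (elems (vertices (h j)))) (allFin k)

  memory : ℕ → ℕ → ℕ
  memory G-offset  = array (offsets 0 (rows g))
  memory G-nbr     = array (concat (rows g))
  memory T-offset  = array (offsets 0 (rows t))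
  memory T-nbr     = array (concat (rows t))
  memory X-offset  = array (offsets 0 (rows x))
  memory X-elem    = array (concat (rows x))
  memory H-offset  = array (offsets 0 (rows (λ j → vertices (h j))))
  memory H-vertex  = array (concat (rows (λ j → vertices (h j))))
  memory HE-offset = array (offsets 0 neighbourhoods)
  memory HE-nbr    = array (concat neighbourhoods)
  memory _         = array []

Holds : (ℕ → ℕ) → List ℕ → Set
Holds f xs = ∀ i → f (toℕ i) ≡ lookup xs i

-- In the state σ, the arrays a and b store the list of lists xss.
Stores : State → ℕ → ℕ → List (List ℕ) → Set
Stores σ a b xss = Holds (arr σ a) (offsets 0 xss) × Holds (arr σ b) (concat xss)

{-# OPTIONS --safe #-}

-- The bags X′ t = { j | V(H j) ∩ X t ≠ ∅ } work: two touching subgraphs share a bag because a common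
-- vertex or a joining edge lies in one; the nodes met by H j are connected because H j is, and
-- consecutive vertices of a walk in H j share a bag; and representatives in X t of an independent set
-- of G(𝓗) form an independent set of G of the same size.
--
-- Both outputs are lists of rows, each row consisting of the i for which H i meets a given set of
-- vertices: the closed neighbourhood of H j for the row j of G(𝓗), and X t for the bag X′ t.  The
-- program stamps this set and then scans the vertex lists of all H i.  Stamping costs O(n + m) for a
-- closed neighbourhood and O(n) for a bag, and scanning costs O(k n), for k + p rows in all.  Stamps
-- increase from row to row, so nothing has to be erased.
module Submission where

open import Defs
open import Data.Bool using (Bool; true; false; T; not; _∧_)
open import Data.Bool.Properties using (T-∧)
open import Data.Empty using (⊥-elim)
open import Data.Fin using (Fin; zero; suc; toℕ; fromℕ<; _<?_)
open import Data.Fin.Properties using (any?; <-cmp; _≟_; toℕ-injective; toℕ<n) renaming (suc-injective to suc-injectiveᶠ)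
open import Data.Fin.Subset using (Subset; Nonempty; inside; outside; ∣_∣; ⁅_⁆; _∪_; _-_; ⊥) renaming (_∈_ to _∈ˢ_)
open import Data.Fin.Subset.Properties using (_∈?_; x∈⁅x⁆; x∈⁅y⁆⇒x≡y; x∈p∪q⁻; x∈p∪q⁺; x∈p∧x≢y⇒x∈p-y; x∈p⇒∣p-x∣<∣p∣; p⊆q⇒∣p∣≤∣q∣; ∉⊥)
open import Data.List using (List; []; _∷_; _∷ʳ_; _++_; map; concat; concatMap; filter; length; lookup; allFin; tabulate; cartesianProduct)
open import Data.List.Extrema.Nat using (max≤v⁺; v≤max⁺)
open import Data.List.Membership.Propositional using (_∈_; find; lose)
open import Data.List.Membership.Propositional.Properties using (∈-++⁺ˡ; ∈-++⁺ʳ; ∈-++⁻; ∈-∃++; ∈-map⁺; ∈-map⁻; ∈-filter⁺; ∈-filter⁻; ∈-concatMap⁺; ∈-concatMap⁻; ∈-cartesianProduct⁺; ∈-allFin)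
open import Data.List.Properties using (length-++; length-map; length-tabulate; map-tabulate; ++-assoc; ++-identityʳ; concat-++; filter-accept; filter-reject)
import Data.List.Relation.Unary.All as All
import Data.List.Relation.Unary.All.Properties as All
open import Data.List.Relation.Unary.AllPairs as AllPairs using (_∷_)
import Data.List.Relation.Unary.AllPairs.Properties as AllPairs
open import Data.List.Relation.Unary.Any as Any using (Any; here; there)
open import Data.List.Relation.Unary.Unique.Propositional using (Unique)
open import Data.List.Relation.Unary.Unique.Propositional.Properties as Unique using (Unique[x∷xs]⇒x∉xs)
open import Data.Nat using (ℕ; zero; suc; _+_; _*_; _∸_; _≤_; _<_; _≡ᵇ_; z≤n; s≤s) renaming (_≟_ to _≟ⁿ_)
open import Data.Nat.ListAction using (sum)
open import Data.Nat.Properties hiding (_≟_; _<?_; <-cmp)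
open import Data.Nat.Tactic.RingSolver using (solve-∀)
open import Data.Product using (_×_; _,_; proj₁; proj₂; ∃-syntax; Σ-syntax; swap)
open import Data.Product.Properties using (,-injectiveˡ; ,-injectiveʳ)
open import Data.Sum using (_⊎_; inj₁; inj₂; [_,_]′)
import Data.Vec as Vec
open import Data.Vec.Properties using ([]=⇒lookup; lookup⇒[]=; lookup∘tabulate)
open import Function using (_∘_; id)
open import Function.Bundles using (_⇔_; mk⇔; module Equivalence)
open import Relation.Binary.Construct.Closure.ReflexiveTransitive as Star using (Star; ε; _◅_; _◅◅_)
open import Relation.Binary.Definitions using (tri<; tri≈; tri>)
open import Relation.Binary.PropositionalEquality using (_≡_; _≢_; refl; sym; trans; cong; cong₂; subst; subst₂)
open import Relation.Nullary using (¬_; Dec; does; yes; no)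
open import Relation.Nullary.Decidable using (_×-dec_)

open Equivalence using (to; from)

-- Cost semantics

update-same : ∀ {A : Set} (f : ℕ → A) x a → update f x a x ≡ a
update-same f x a with x ≡ᵇ x | ≡⇒≡ᵇ x x refl
... | true | _ = refl

update-other : ∀ {A : Set} (f : ℕ → A) x a y → T (not (x ≡ᵇ y)) → update f x a y ≡ f y
update-other f x a y x≢y with x ≡ᵇ y
... | false = refl

≢⇒not≡ᵇ : ∀ {x y} → x ≢ y → T (not (x ≡ᵇ y))
≢⇒not≡ᵇ {x} {y} x≢y with x ≡ᵇ y in eq
... | false = _
... | true  = x≢y (≡ᵇ⇒≡ x y (subst T (sym eq) _))

-- A syntactic frame condition. Being computed, it reduces to the unit type for concrete registers
-- and programs, so that its proofs can be left implicit.
keepsReg : ℕ → Cmd → Bool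
keepsReg x skip          = true
keepsReg x (y ≔ _)       = not (y ≡ᵇ x)
keepsReg x (_ [ _ ]≔ _)  = true
keepsReg x (c ﹔ d)       = keepsReg x c ∧ keepsReg x d
keepsReg x (ifnz _ c d)  = keepsReg x c ∧ keepsReg x d
keepsReg x (whilenz _ c) = keepsReg x c

keepsArr : ℕ → Cmd → Bool
keepsArr a skip          = true
keepsArr a (_ ≔ _)       = true
keepsArr a (b [ _ ]≔ _)  = not (b ≡ᵇ a)
keepsArr a (c ﹔ d)       = keepsArr a c ∧ keepsArr a d
keepsArr a (ifnz _ c d)  = keepsArr a c ∧ keepsArr a d
keepsArr a (whilenz _ c) = keepsArr a c

∧-fst : ∀ x {y} → T (x ∧ y) → T x
∧-fst x = proj₁ ∘ Equivalence.to (T-∧ {x})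

∧-snd : ∀ x {y} → T (x ∧ y) → T y
∧-snd x = proj₂ ∘ Equivalence.to (T-∧ {x})

reg-kept : ∀ x {c σ σ′ τ} → ⟨ c , σ ⟩⇓⟨ σ′ , τ ⟩ → T (keepsReg x c) → reg σ′ x ≡ reg σ x
reg-kept x ⇓skip                    _ = refl
reg-kept x (⇓reg {σ} {y} {e})       k = update-other (reg σ) y (⟦ e ⟧ σ) x k
reg-kept x ⇓arr                     _ = refl
reg-kept x (⇓seq {c = c} r s)       k = trans (reg-kept x s (∧-snd (keepsReg x c) k)) (reg-kept x r (∧-fst (keepsReg x c) k))
reg-kept x (⇓then {c = c} _ r)      k = reg-kept x r (∧-fst (keepsReg x c) k)
reg-kept x (⇓else {c = c} _ r)      k = reg-kept x r (∧-snd (keepsReg x c) k)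
reg-kept x (⇓done _)                _ = refl
reg-kept x (⇓loop _ r s)            k = trans (reg-kept x s k) (reg-kept x r k)

arr-kept : ∀ a {c σ σ′ τ} → ⟨ c , σ ⟩⇓⟨ σ′ , τ ⟩ → T (keepsArr a c) → arr σ′ a ≡ arr σ a
arr-kept a ⇓skip                    _ = refl
arr-kept a ⇓reg                     _ = refl
arr-kept a (⇓arr {σ} {b})           k = update-other (arr σ) b _ a k
arr-kept a (⇓seq {c = c} r s)       k = trans (arr-kept a s (∧-snd (keepsArr a c) k)) (arr-kept a r (∧-fst (keepsArr a c) k))
arr-kept a (⇓then {c = c} _ r)      k = arr-kept a r (∧-fst (keepsArr a c) k)
arr-kept a (⇓else {c = c} _ r)      k = arr-kept a r (∧-snd (keepsArr a c) k)
arr-kept a (⇓done _)                _ = refl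
arr-kept a (⇓loop _ r s)            k = trans (arr-kept a s k) (arr-kept a r k)

record Unchanged (c : Cmd) (σ σ′ : State) : Set where
  field
    reg= : ∀ x {_ : T (keepsReg x c)} → reg σ′ x ≡ reg σ x
    arr= : ∀ a {_ : T (keepsArr a c)} → arr σ′ a ≡ arr σ a
open Unchanged public

unchanged : ∀ {c σ σ′ τ} → ⟨ c , σ ⟩⇓⟨ σ′ , τ ⟩ → Unchanged c σ σ′
unchanged r = record { reg= = λ x {k} → reg-kept x r k ; arr= = λ a {k} → arr-kept a r k }

-- Hoare triples with a time bound.

Run : Cmd → State → ℕ → (State → Set) → Set
Run c σ t Q = ∃[ σ′ ] ∃[ τ ] (⟨ c , σ ⟩⇓⟨ σ′ , τ ⟩ × τ ≤ t × Q σ′)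

within : ∀ {c σ t u Q} → t ≤ u → Run c σ t Q → Run c σ u Q
within t≤u (σ′ , τ , r , τ≤t , q) = σ′ , τ , r , ≤-trans τ≤t t≤u , q

conclude : ∀ {c σ t} {Q R : State → Set} → (∀ σ′ → Q σ′ → R σ′) → Run c σ t Q → Run c σ t R
conclude f (σ′ , τ , r , τ≤t , q) = σ′ , τ , r , τ≤t , f σ′ q

run-skip : ∀ {σ} {Q : State → Set} → Q σ → Run skip σ 1 Q
run-skip q = _ , _ , ⇓skip , ≤-refl , q

run-reg : ∀ {x e σ} {Q : State → Set} → Q (setReg x (⟦ e ⟧ σ) σ) → Run (x ≔ e) σ (1 + cost e) Q
run-reg q = _ , _ , ⇓reg , ≤-refl , q

run-arr : ∀ {a e f σ} {Q : State → Set} → Q (setArr a (⟦ e ⟧ σ) (⟦ f ⟧ σ) σ) → Run (a [ e ]≔ f) σ (1 + cost e + cost f) Q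
run-arr q = _ , _ , ⇓arr , ≤-refl , q

-- The frame rule is built in: the continuation also learns that whatever `c` never assigns is
-- unchanged, so `R` need only describe what `c` changes.
run-seq : ∀ {c d σ t u} {Q R : State → Set} → Run c σ t R →
  (∀ {σ′} → Unchanged c σ σ′ → R σ′ → Run d σ′ u Q) → Run (c ﹔ d) σ (t + u) Q
run-seq (σ₁ , τ₁ , r₁ , ≤t , q₁) f with f (unchanged r₁) q₁
... | σ₂ , τ₂ , r₂ , ≤u , q₂ = σ₂ , _ , ⇓seq r₁ r₂ , +-mono-≤ ≤t ≤u , q₂

then-reg : ∀ {x e d σ u} {Q : State → Set} → Run d (setReg x (⟦ e ⟧ σ) σ) u Q → Run (x ≔ e ﹔ d) σ (1 + cost e + u) Q
then-reg (σ′ , τ , r , ≤u , q) = σ′ , _ , ⇓seq ⇓reg r , +-monoʳ-≤ _ ≤u , q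

then-arr : ∀ {a e f d σ u} {Q : State → Set} → Run d (setArr a (⟦ e ⟧ σ) (⟦ f ⟧ σ) σ) u Q →
  Run (a [ e ]≔ f ﹔ d) σ (1 + cost e + cost f + u) Q
then-arr (σ′ , τ , r , ≤u , q) = σ′ , _ , ⇓seq ⇓arr r , +-monoʳ-≤ _ ≤u , q

run-ifnz : ∀ {e c d σ t} {Q : State → Set} →
  (⟦ e ⟧ σ ≢ 0 → Run c σ t Q) → (⟦ e ⟧ σ ≡ 0 → Run d σ t Q) → Run (ifnz e c d) σ (1 + cost e + t) Q
run-ifnz {e} {σ = σ} f g with ⟦ e ⟧ σ ≟ⁿ 0
... | no ≢0 with f ≢0
...   | σ′ , τ , r , ≤t , q = σ′ , _ , ⇓then ≢0 r , +-monoʳ-≤ _ ≤t , q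
run-ifnz {e} {σ = σ} f g | yes ≡0 with g ≡0
...   | σ′ , τ , r , ≤t , q = σ′ , _ , ⇓else ≡0 r , +-monoʳ-≤ _ ≤t , q

-- The list occupies the positions from the first index (included) to the last (excluded). `At` is a
-- parameter so that the same notion serves for memory contents and for counters, where `At i x` is
-- `i ≡ toℕ x`.
data Span {A : Set} (At : ℕ → A → Set) : ℕ → List A → ℕ → Set where
  []  : ∀ {i} → Span At i [] i
  _∷_ : ∀ {i e x xs} → At i x → Span At (suc i) xs e → Span At i (x ∷ xs) e

span-≤ : ∀ {A : Set} {At : ℕ → A → Set} {i xs e} → Span At i xs e → i ≤ e
span-≤ []      = ≤-refl
span-≤ (_ ∷ s) = ≤-trans (n≤1+n _) (span-≤ s)

loop : ℕ → ℕ → Cmd → Cmd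
loop i e c = whilenz (var e ⊖ var i) (c ﹔ i ≔ var i ⊕ lit 1)

-- Each round costs 4 for the guard and 4 for the increment besides the body; the final 4 is the
-- failing guard.
loopTime : ∀ {A : Set} → (A → ℕ) → List A → ℕ
loopTime f xs = sum (map (λ x → 8 + f x) xs) + 4

module _ {A : Set} {At : ℕ → A → Set} {i e : ℕ} {c : Cmd}
  {k-i : T (keepsReg i c)} {k-e : T (keepsReg e c)} {i≢e : T (not (i ≡ᵇ e))}
  (I : List A → State → Set) (f : A → ℕ) {σ₀ : State}
  (body : ∀ {x xs σ} → Unchanged (loop i e c) σ₀ σ → At (reg σ i) x → I (x ∷ xs) σ →
    Run c σ (f x) (λ σ′ → I xs (setReg i (reg σ′ i + 1) σ′))) where

  -- The induction moves the current state, whereas the frame information stays relative to the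
  -- initial state `σ₀`; the body may thus use any fact about `σ₀` that the loop cannot affect. The
  -- invariant `I` is indexed by the elements still to be processed.
  run-loop-from : ∀ {xs σ} → Unchanged (loop i e c) σ₀ σ → Span At (reg σ i) xs (reg σ e) → I xs σ →
    Run (loop i e c) σ (loopTime f xs) (I [])
  run-loop-from {[]} {σ} u s inv = σ , _ , ⇓done (done s) , ≤-refl , inv
    where
    done : ∀ {m l} → Span At m [] l → l ∸ m ≡ 0
    done {m} [] = n∸n≡0 m
  run-loop-from {x ∷ xs} {σ} u (a ∷ s) inv with body u a inv
  ... | σ₁ , τ₁ , r₁ , ≤f , inv₁ with run-loop-from {xs} u₂ s₂ inv₁
    where
    σ₂ = setReg i (reg σ₁ i + 1) σ₁
    r₂ : ⟨ c ﹔ i ≔ var i ⊕ lit 1 , σ ⟩⇓⟨ σ₂ , τ₁ + 4 ⟩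
    r₂ = ⇓seq r₁ ⇓reg
    u₂ : Unchanged (loop i e c) σ₀ σ₂
    u₂ = record
      { reg= = λ y {k} → trans (reg-kept y r₂ k) (reg= u y {k})
      ; arr= = λ b {k} → trans (arr-kept b r₂ k) (arr= u b {k}) }
    i= : reg σ₂ i ≡ suc (reg σ i)
    i= = trans (update-same (reg σ₁) i _) (trans (cong (_+ 1) (reg-kept i r₁ k-i)) (+-comm (reg σ i) 1))
    e= : reg σ₂ e ≡ reg σ e
    e= = trans (update-other (reg σ₁) i _ e i≢e) (reg-kept e r₁ k-e)
    s₂ = subst₂ (λ m l → Span At m xs l) (sym i=) (sym e=) s
  ... | σ₃ , τ₃ , r₃ , ≤t , q = σ₃ , _ , ⇓loop guard (⇓seq r₁ ⇓reg) r₃ , time , q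
    where
    -- The tail starts at position `suc (reg σ i)` and ends at `reg σ e`, so the truncated
    -- difference is positive.
    guard : reg σ e ∸ reg σ i ≢ 0
    guard eq = <⇒≱ (span-≤ s) (m∸n≡0⇒m≤n eq)
    open ≤-Reasoning
    time : 4 + (τ₁ + 4) + τ₃ ≤ loopTime f (x ∷ xs)
    time = begin
      4 + (τ₁ + 4) + τ₃                              ≡⟨ cong (λ z → 4 + z + τ₃) (+-comm τ₁ 4) ⟩
      8 + τ₁ + τ₃                                    ≤⟨ +-mono-≤ (+-monoʳ-≤ 8 ≤f) ≤t ⟩
      8 + f x + loopTime f xs                        ≡⟨ +-assoc (8 + f x) _ 4 ⟨
      loopTime f (x ∷ xs)                            ∎

  run-loop : ∀ {xs} → Span At (reg σ₀ i) xs (reg σ₀ e) → I xs σ₀ → Run (loop i e c) σ₀ (loopTime f xs) (I [])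
  run-loop = run-loop-from (record { reg= = λ _ → refl ; arr= = λ _ → refl })

loopTime-≤ : ∀ {A : Set} {f : A → ℕ} b l → (∀ x → f x ≤ b) → ∀ xs → length xs ≤ l → loopTime f xs ≤ l * (8 + b) + 4
loopTime-≤ {f = f} b l f≤b xs ≤l = +-monoˡ-≤ 4 (≤-trans (go xs) (*-monoˡ-≤ (8 + b) ≤l))
  where
  go : ∀ xs → sum (map (λ x → 8 + f x) xs) ≤ length xs * (8 + b)
  go []       = z≤n
  go (x ∷ xs) = +-mono-≤ (+-monoʳ-≤ 8 (f≤b x)) (go xs)

-- The graph G(𝓗) and its tree decomposition

∈-tabulate-lookup⁺ : ∀ {n p} {X : Fin p → Subset n} {u t} → u ∈ˢ X t → t ∈ˢ Vec.tabulate (λ t → Vec.lookup (X t) u)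
∈-tabulate-lookup⁺ {t = t} u∈ = lookup⇒[]= t _ (trans (lookup∘tabulate _ t) ([]=⇒lookup u∈))

∈-tabulate-lookup⁻ : ∀ {n p} {X : Fin p → Subset n} {u t} → t ∈ˢ Vec.tabulate (λ t → Vec.lookup (X t) u) → u ∈ˢ X t
∈-tabulate-lookup⁻ {X = X} {u} {t} t∈ = lookup⇒[]= u _ (trans (sym (lookup∘tabulate (λ t → Vec.lookup (X t) u) t)) ([]=⇒lookup t∈))

∈-tabulate-does⁺ : ∀ {k} {P : Fin k → Set} (P? : ∀ j → Dec (P j)) {j} → P j → j ∈ˢ Vec.tabulate (does ∘ P?)
∈-tabulate-does⁺ P? {j} pj = lookup⇒[]= j _ (trans (lookup∘tabulate _ j) (holds (P? j)))
  where
  holds : (d : Dec _) → does d ≡ true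
  holds (yes _)  = refl
  holds (no ¬pj) = ⊥-elim (¬pj pj)

∈-tabulate-does⁻ : ∀ {k} {P : Fin k → Set} (P? : ∀ j → Dec (P j)) {j} → j ∈ˢ Vec.tabulate (does ∘ P?) → P j
∈-tabulate-does⁻ {P = P} P? {j} j∈ = holds (P? j) (trans (sym (lookup∘tabulate _ j)) ([]=⇒lookup j∈))
  where
  holds : (d : Dec (P j)) → does d ≡ true → P j
  holds (yes pj) _ = pj

∈-subsets : ∀ {n} (S : Subset n) → S ∈ subsets n
∈-subsets Vec.[]              = here refl
∈-subsets (outside Vec.∷ S)   = ∈-++⁺ˡ (∈-map⁺ _ (∈-subsets S))
∈-subsets {suc n} (inside Vec.∷ S) = ∈-++⁺ʳ (map (outside Vec.∷_) (subsets n)) (∈-map⁺ _ (∈-subsets S))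

α-≤ : ∀ {n} {G : Graph n} {H : Subgraph G} {b} → (∀ S → Independent H S → ∣ S ∣ ≤ b) → α H ≤ b
α-≤ {H = H} bound = max≤v⁺ z≤n (All.map⁺ (All.map (λ {S} → bound S) (All.all-filter (independent? H) (subsets _))))

≤-α : ∀ {n} {G : Graph n} {H : Subgraph G} {S} → Independent H S → ∣ S ∣ ≤ α H
≤-α {H = H} {S} ind = v≤max⁺ 0 _ (inj₂ (Any.map ≤-reflexive (∈-map⁺ ∣_∣ (∈-filter⁺ (independent? H) (∈-subsets S) ind))))

-- `p` lies in `⁅ x ⁆ ∪ p` with `x` deleted, and deleting the member `x` lowers the size.
∣⁅x⁆∪p∣ : ∀ {n} {x : Fin n} {p} → ¬ x ∈ˢ p → suc ∣ p ∣ ≤ ∣ ⁅ x ⁆ ∪ p ∣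
∣⁅x⁆∪p∣ {x = x} {p} x∉p = ≤-trans
  (s≤s (p⊆q⇒∣p∣≤∣q∣ {p = p} {q = (⁅ x ⁆ ∪ p) - x} (λ y∈p → x∈p∧x≢y⇒x∈p-y (x∈p∪q⁺ {p = ⁅ x ⁆} (inj₂ y∈p)) λ { refl → x∉p y∈p })))
  (x∈p⇒∣p-x∣<∣p∣ {p = ⁅ x ⁆ ∪ p} (x∈p∪q⁺ (inj₁ (x∈⁅x⁆ x))))

-- One image is added per member of `S`, and injectivity keeps it from being an image of another
-- member. `R` is a relation because representatives are only required for members of `S`.
injective-image : ∀ {k n} (S : Subset k) (R : Fin k → Fin n → Set) →
  (∀ {j} → j ∈ˢ S → ∃[ v ] R j v) → (∀ {i j v} → i ∈ˢ S → j ∈ˢ S → R i v → R j v → i ≡ j) →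
  ∃[ S′ ] ((∀ {v} → v ∈ˢ S′ → ∃[ j ] (j ∈ˢ S × R j v)) × ∣ S ∣ ≤ ∣ S′ ∣)
injective-image Vec.[] R tot inj = ⊥ , (λ v∈ → ⊥-elim (∉⊥ v∈)) , z≤n
injective-image (s Vec.∷ S) R tot inj
  with injective-image S (λ j → R (suc j)) (tot ∘ Vec.there) (λ i∈ j∈ r r′ → suc-injectiveᶠ (inj (Vec.there i∈) (Vec.there j∈) r r′))
injective-image (outside Vec.∷ S) R tot inj | S′ , img , ≤S′ =
  S′ , (λ v∈ → let j , j∈ , r = img v∈ in suc j , Vec.there j∈ , r) , ≤S′
injective-image (inside Vec.∷ S) R tot inj | S′ , img , ≤S′ =
  ⁅ v ⁆ ∪ S′ , img′ , ≤-trans (s≤s ≤S′) (∣⁅x⁆∪p∣ v∉S′)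
  where
  v = proj₁ (tot Vec.here)
  r₀ = proj₂ (tot Vec.here)
  v∉S′ : ¬ v ∈ˢ S′
  v∉S′ v∈ with img v∈
  ... | j , j∈ , r with inj Vec.here (Vec.there j∈) r₀ r
  ...   | ()
  img′ : ∀ {w} → w ∈ˢ ⁅ v ⁆ ∪ S′ → ∃[ j ] (j ∈ˢ (inside Vec.∷ S) × R j w)
  img′ w∈ with x∈p∪q⁻ ⁅ v ⁆ S′ w∈
  ... | inj₁ w∈⁅v⁆ rewrite x∈⁅y⁆⇒x≡y v w∈⁅v⁆ = zero , Vec.here , r₀
  ... | inj₂ w∈S′ = let j , j∈ , r = img w∈S′ in suc j , Vec.there j∈ , r

module _ {n k p : ℕ} {G : Graph n} (H : Fin k → Subgraph G) (X : Fin p → Subset n) where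
  open Graph G
  open Subgraph using (V)

  Meets : Fin p → Fin k → Set
  Meets t j = ∃[ v ] (v ∈ˢ V (H j) × v ∈ˢ X t)

  meets? : ∀ t j → Dec (Meets t j)
  meets? t j = any? (λ v → (v ∈? V (H j)) ×-dec (v ∈? X t))

  meetingBags : Fin p → Subset k
  meetingBags t = Vec.tabulate (does ∘ meets? t)

  meetingBags-treeDecomposition : ∀ {T} → (∀ j → Connected (H j)) → (∀ j → ∃[ v ] v ∈ˢ V (H j)) →
    IsTreeDecomposition G T X → IsTreeDecomposition (G ⟨ H ⟩) T meetingBags
  meetingBags-treeDecomposition {T} conn nonnull td = record
    { isTree         = isTree
    ; vertex-covered = λ j → let v , v∈ = nonnull j ; t , v∈t = vertex-covered v in t , member v∈ v∈t
    ; edge-covered   = λ { {i} {j} (_ , touch) → edge touch }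
    ; connected      = λ j {t} {u} t∈ u∈ →
        let v , v∈ , v∈t = ∈-tabulate-does⁻ (meets? t) (∈-tabulate-lookup⁻ {X = meetingBags} t∈)
            w , w∈ , w∈u = ∈-tabulate-does⁻ (meets? u) (∈-tabulate-lookup⁻ {X = meetingBags} u∈)
        in path j (conn j v∈ w∈) v∈ v∈t w∈u
    }
    where
    open IsTreeDecomposition td

    member : ∀ {j v t} → v ∈ˢ V (H j) → v ∈ˢ X t → j ∈ˢ meetingBags t
    member {t = t} v∈ v∈t = ∈-tabulate-does⁺ (meets? t) (_ , v∈ , v∈t)

    edge : ∀ {i j} → (∃[ v ] (v ∈ˢ V (H i) × v ∈ˢ V (H j))) ⊎ (∃[ u ] ∃[ v ] (u ∈ˢ V (H i) × v ∈ˢ V (H j) × u ∼ v)) →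
      ∃[ t ] (i ∈ˢ meetingBags t × j ∈ˢ meetingBags t)
    edge (inj₁ (v , v∈i , v∈j)) = let t , v∈t = vertex-covered v in t , member v∈i v∈t , member v∈j v∈t
    edge (inj₂ (u , v , u∈i , v∈j , e)) = let t , u∈t , v∈t = edge-covered e in t , member u∈i u∈t , member v∈j v∈t

    Walk : Fin k → Fin p → Fin p → Set
    Walk j = Star (Subgraph._~_ (induced T (Vec.tabulate (λ t → Vec.lookup (meetingBags t) j))))

    within-vertex : ∀ j {v t u} → v ∈ˢ V (H j) → v ∈ˢ X t → v ∈ˢ X u → Walk j t u
    within-vertex j {v} v∈ v∈t v∈u = Star.map
      (λ (a , b , e) → enlarge a , enlarge b , e)
      (connected v (∈-tabulate-lookup⁺ {X = X} v∈t) (∈-tabulate-lookup⁺ {X = X} v∈u))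
      where
      enlarge : ∀ {s} → s ∈ˢ Vec.tabulate (λ t → Vec.lookup (X t) v) → s ∈ˢ Vec.tabulate (λ t → Vec.lookup (meetingBags t) j)
      enlarge s∈ = ∈-tabulate-lookup⁺ {X = meetingBags} (member v∈ (∈-tabulate-lookup⁻ {X = X} s∈))

    path : ∀ j {v w t u} → Star (Subgraph._~_ (H j)) v w → v ∈ˢ V (H j) → v ∈ˢ X t → w ∈ˢ X u → Walk j t u
    path j ε        v∈ v∈t w∈u = within-vertex j v∈ v∈t w∈u
    path j (e ◅ es) v∈ v∈t w∈u =
      -- The bag of `s` contains both ends of the first edge: the walk reaches `s` among the nodes
      -- containing the first end and goes on from `s` with the second end.
      let s , v∈s , v′∈s = edge-covered (Subgraph.~⇒∼ (H j) e)
      in within-vertex j v∈ v∈t v∈s ◅◅ path j es (Subgraph.~⇒∈V (H j) (Subgraph.~-sym (H j) e)) v′∈s w∈u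

  -- The witness computed by meets? is the chosen representative of H j in X t.
  Represents : Fin p → Fin k → Fin n → Set
  Represents t j v = ∃[ m ] (meets? t j ≡ yes m × proj₁ m ≡ v)

  -- Representatives in X t of pairwise non-touching subgraphs are distinct and non-adjacent.
  α-meetingBags : ∀ t → α (induced (G ⟨ H ⟩) (meetingBags t)) ≤ α (induced G (X t))
  α-meetingBags t = α-≤ {H = induced (G ⟨ H ⟩) (meetingBags t)} bound
    where
    represented : ∀ {j} → Meets t j → ∃[ v ] Represents t j v
    represented {j} m = go (meets? t j) refl
      where
      go : (d : Dec (Meets t j)) → meets? t j ≡ d → ∃[ v ] Represents t j v
      go (yes m′) eq = proj₁ m′ , m′ , eq , refl
      go (no ¬m)  eq = ⊥-elim (¬m m)

    represents⇒∈ : ∀ {j v} → Represents t j v → v ∈ˢ V (H j) × v ∈ˢ X t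
    represents⇒∈ ((_ , v∈ , v∈t) , _ , refl) = v∈ , v∈t

    -- Both witnesses come from the same value `meets? t j`, which is why `Represents` records an
    -- equation about the decision procedure.
    functional : ∀ {j u v} → Represents t j u → Represents t j v → u ≡ v
    functional (_ , eq , refl) (_ , eq′ , refl) with trans (sym eq) eq′
    ... | refl = refl

    bound : ∀ S → Independent (induced (G ⟨ H ⟩) (meetingBags t)) S → ∣ S ∣ ≤ α (induced G (X t))
    bound S (S⊆ , ind) with injective-image S (Represents t) (λ j∈ → represented (∈-tabulate-does⁻ (meets? t) (S⊆ j∈))) inj
      where
      inj : ∀ {i j v} → i ∈ˢ S → j ∈ˢ S → Represents t i v → Represents t j v → i ≡ j
      inj {i} {j} {v} i∈ j∈ ri rj with i ≟ j
      ... | yes i≡j = i≡j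
      -- A shared representative is a common vertex, which makes `i` and `j` adjacent in `G ⟨ H ⟩`.
      ... | no  i≢j = ⊥-elim (ind i j i∈ j∈
        (S⊆ i∈ , S⊆ j∈ , i≢j , inj₁ (v , proj₁ (represents⇒∈ ri) , proj₁ (represents⇒∈ rj))))
    ... | S′ , img , ≤S′ = ≤-trans ≤S′ (≤-α {H = induced G (X t)}
        ((λ v∈ → proj₂ (represents⇒∈ (proj₂ (proj₂ (img v∈))))) , ind′))
      where
      ind′ : ∀ u v → u ∈ˢ S′ → v ∈ˢ S′ → ¬ (u ∈ˢ X t × v ∈ˢ X t × u ∼ v)
      ind′ u v u∈ v∈ (_ , _ , e) with img u∈ | img v∈
      ... | i , i∈ , ru | j , j∈ , rv with i ≟ j
      ...   | no  i≢j  = ind i j i∈ j∈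
        (S⊆ i∈ , S⊆ j∈ , i≢j , inj₂ (u , v , proj₁ (represents⇒∈ ru) , proj₁ (represents⇒∈ rv) , e))
      -- Two representatives of the same subgraph coincide, so the edge between them would be a
      -- loop.
      ...   | yes refl = ∼-irrefl (subst (u ∼_) (functional rv ru) e)

  α-bags-meetingBags : α-bags (G ⟨ H ⟩) meetingBags ≤ α-bags G X
  α-bags-meetingBags = max≤v⁺ z≤n (All.map⁺ (All.universal
    (λ t → ≤-trans (α-meetingBags t) (v≤max⁺ 0 _ (inj₂ (Any.map ≤-reflexive (∈-map⁺ _ (∈-allFin t)))))) (allFin p)))

-- Counting with lists without repetition.

unique-⊆-length : ∀ {A : Set} {xs ys : List A} → Unique xs → (∀ {x} → x ∈ xs → x ∈ ys) → length xs ≤ length ys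
unique-⊆-length {xs = []}     u sub = z≤n
unique-⊆-length {xs = x ∷ xs} u@(_ ∷ uxs) sub with ∈-∃++ (sub (here refl))
... | ys , zs , refl = begin
  suc (length xs)            ≤⟨ s≤s (unique-⊆-length uxs sub′) ⟩
  suc (length (ys ++ zs))    ≡⟨ cong suc (length-++ ys) ⟩
  suc (length ys + length zs) ≡⟨ +-suc (length ys) (length zs) ⟨
  length ys + suc (length zs) ≡⟨ length-++ ys ⟨
  length (ys ++ x ∷ zs)      ∎
  where
  open ≤-Reasoning
  -- Deleting one occurrence of `x` from the larger list loses no member of `xs`, as `x` does not
  -- occur in `xs`.
  sub′ : ∀ {y} → y ∈ xs → y ∈ ys ++ zs
  sub′ y∈ with ∈-++⁻ ys (sub (there y∈))
  ... | inj₁ y∈ys         = ∈-++⁺ˡ y∈ys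
  ... | inj₂ (here refl)  = ⊥-elim (Unique[x∷xs]⇒x∉xs u y∈)
  ... | inj₂ (there y∈zs) = ∈-++⁺ʳ ys y∈zs

listing-length : ∀ {n} {P : Fin n → Set} (ℓ : Listing P) → length (elems ℓ) ≤ n
listing-length ℓ = ≤-trans (unique-⊆-length (Listing.unique ℓ) (λ {x} _ → ∈-allFin x)) (≤-reflexive (length-tabulate id))

-- Every ordered pair of adjacent vertices is an edge or the reversal of one.
degree-sum : ∀ {n} {G : Graph n} (g : AdjacencyLists G) {vs : List (Fin n)} → Unique vs →
  sum (map (λ v → length (elems (g v))) vs) ≤ 2 * ∣E∣ G
degree-sum {n} {G} g {vs} uniq = begin
  sum (map (λ v → length (elems (g v))) vs)  ≡⟨ arcs-length vs ⟨
  length (arcs vs)                           ≤⟨ unique-⊆-length unique-arcs arcs⊆ ⟩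
  length (edges ++ map swap edges)           ≡⟨ length-++ edges ⟩
  length edges + length (map swap edges)     ≡⟨ cong (length edges +_) (trans (length-map swap edges) (sym (+-identityʳ _))) ⟩
  2 * ∣E∣ G                                  ∎
  where
  open ≤-Reasoning
  open Graph G

  edges : List (Fin n × Fin n)
  edges = filter (λ (u , v) → (u <? v) ×-dec (u ∼? v)) (cartesianProduct (allFin n) (allFin n))

  star : Fin n → List (Fin n × Fin n)
  star v = map (v ,_) (elems (g v))

  arcs : List (Fin n) → List (Fin n × Fin n)
  arcs = concatMap star

  arcs-length : ∀ vs → length (arcs vs) ≡ sum (map (λ v → length (elems (g v))) vs)
  arcs-length []       = refl
  arcs-length (v ∷ vs) = trans (length-++ (star v)) (cong₂ _+_ (length-map (v ,_) (elems (g v))) (arcs-length vs))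

  -- Arcs from one vertex differ in the second component, arcs from distinct vertices in the first.
  unique-arcs : Unique (arcs vs)
  unique-arcs = Unique.concat⁺
    (All.map⁺ (All.universal (λ v → Unique.map⁺ ,-injectiveʳ (Listing.unique (g v))) vs))
    (AllPairs.map⁺ (AllPairs.map disjoint uniq))
    where
    disjoint : ∀ {u v} → u ≢ v → ∀ {a} → ¬ (a ∈ star u × a ∈ star v)
    disjoint u≢v (a∈u , a∈v) with ∈-map⁻ _ a∈u | ∈-map⁻ _ a∈v
    ... | _ , _ , refl | _ , _ , eq = u≢v (,-injectiveˡ eq)

  arcs⊆ : ∀ {a} → a ∈ arcs vs → a ∈ edges ++ map swap edges
  arcs⊆ a∈ with Any.satisfied (∈-concatMap⁻ star {xs = vs} a∈)
  ... | u , a∈u with ∈-map⁻ _ a∈u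
  ...   | v , v∈ , refl with Listing.sound (g u) v∈ | <-cmp u v
  ...     | e | tri< u<v _ _    = ∈-++⁺ˡ (∈-filter⁺ _ (∈-cartesianProduct⁺ (∈-allFin u) (∈-allFin v)) (u<v , e))
  ...     | e | tri≈ _ refl _   = ⊥-elim (∼-irrefl e)
  ...     | e | tri> _ _ v<u    = ∈-++⁺ʳ edges (∈-map⁺ swap (∈-filter⁺ _ (∈-cartesianProduct⁺ (∈-allFin v) (∈-allFin u)) (v<u , ∼-sym e)))

-- The elements come in increasing order, the order in which `scan` visits the indices, so that the
-- program's output is literally this list.
filterListing : ∀ {n} {P : Fin n → Set} → (∀ i → Dec (P i)) → Listing P
filterListing {n} P? = record
  { elems    = filter P? (allFin n)
  ; unique   = Unique.filter⁺ P? (Unique.allFin⁺ n)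
  ; sound    = λ i∈ → proj₂ (∈-filter⁻ P? {xs = allFin n} i∈)
  ; complete = λ {i} → ∈-filter⁺ P? (∈-allFin i)
  }

-- Lists in memory

Entry : (ℕ → ℕ) → ℕ → ℕ → Set
Entry f i x = f i ≡ x

span-length : ∀ {A : Set} {At : ℕ → A → Set} {i xs e} → Span At i xs e → e ≡ i + length xs
span-length {i = i} []                  = sym (+-identityʳ i)
span-length {i = i} (_∷_ {xs = xs} _ s) = trans (span-length s) (sym (+-suc i (length xs)))

span-++⁻ : ∀ {A : Set} {At : ℕ → A → Set} {i e} xs {ys} → Span At i (xs ++ ys) e → Σ[ m ∈ ℕ ] (Span At i xs m × Span At m ys e)
span-++⁻ []       s       = _ , [] , s
span-++⁻ (x ∷ xs) (a ∷ s) = let m , s₁ , s₂ = span-++⁻ xs s in m , a ∷ s₁ , s₂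

span-∷ʳ : ∀ {A : Set} {At : ℕ → A → Set} {i xs e x} → Span At i xs e → At e x → Span At i (xs ∷ʳ x) (suc e)
span-∷ʳ []      a′ = a′ ∷ []
span-∷ʳ (a ∷ s) a′ = a ∷ span-∷ʳ s a′

span-map⁻ : ∀ {A B : Set} {At : ℕ → B → Set} {h : A → B} {i e} xs → Span At i (map h xs) e → Span (λ j x → At j (h x)) i xs e
span-map⁻ []       []      = []
span-map⁻ (x ∷ xs) (a ∷ s) = a ∷ span-map⁻ xs s

span-update : ∀ {f i xs e j y} → Span (Entry f) i xs e → e ≤ j → Span (Entry (update f j y)) i xs e
span-update []                              e≤j = []
span-update {f} {i} {j = j} {y} (refl ∷ s) e≤j =
  update-other f j y i (≢⇒not≡ᵇ (>⇒≢ (<-≤-trans (span-≤ s) e≤j))) ∷ span-update s e≤j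

span-append : ∀ {f i xs e y} → Span (Entry f) i xs e → Span (Entry (update f e y)) i (xs ∷ʳ y) (suc e)
span-append {f} {e = e} {y} s = span-∷ʳ (span-update s ≤-refl) (update-same f e y)

span⇒Holds : ∀ {f xs e} → Span (Entry f) 0 xs e → Holds f xs
span⇒Holds s = go s
  where
  go : ∀ {f i xs e} → Span (Entry f) i xs e → ∀ j → f (i + toℕ j) ≡ lookup xs j
  go {f} {i} (a ∷ s) zero    = trans (cong f (+-identityʳ i)) a
  go {f} {i} (a ∷ s) (suc j) = trans (cong f (+-suc i (toℕ j))) (go s j)

span-array : ∀ xs → Span (Entry (array xs)) 0 xs (length xs)
span-array []       = []
span-array (x ∷ xs) = refl ∷ shift (span-array xs)
  where
  shift : ∀ {i ys e} → Span (Entry (array xs)) i ys e → Span (Entry (array (x ∷ xs))) (suc i) ys (suc e)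
  shift []      = []
  shift (a ∷ s) = a ∷ shift s

span-allFin : ∀ k → Span (λ i x → i ≡ toℕ x) 0 (allFin k) k
span-allFin k = go id (λ _ → refl)
  where
  go : ∀ {m n i} (f : Fin m → Fin n) → (∀ x → i + toℕ x ≡ toℕ (f x)) → Span (λ i x → i ≡ toℕ x) i (tabulate f) (i + m)
  go {zero}  {i = i} f eq rewrite +-identityʳ i = []
  go {suc m} {i = i} f eq rewrite +-suc i m =
    trans (sym (+-identityʳ i)) (eq zero) ∷ go (f ∘ suc) (λ x → trans (sym (+-suc i (toℕ x))) (eq (suc x)))

-- For `o = 0` the new last offset is the total number of elements written, which is the value of
-- `pos` when a row is finished.
offsets-∷ʳ : ∀ o xss xs → offsets o (xss ∷ʳ xs) ≡ offsets o xss ∷ʳ (o + length (concat (xss ∷ʳ xs)))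
offsets-∷ʳ o []         xs = cong (λ l → o ∷ (o + length l) ∷ []) (sym (++-identityʳ xs))
offsets-∷ʳ o (ys ∷ xss) xs = cong (o ∷_) (trans (offsets-∷ʳ (o + length ys) xss xs)
  (cong (λ m → offsets (o + length ys) xss ∷ʳ m) (trans (+-assoc o _ _) (cong (o +_) (sym (length-++ ys))))))

concat-∷ʳ : ∀ {A : Set} (xss : List (List A)) xs → concat (xss ∷ʳ xs) ≡ concat xss ++ xs
concat-∷ʳ xss xs = trans (sym (concat-++ xss (xs ∷ []))) (cong (concat xss ++_) (++-identityʳ xs))

-- The counterpart of `Stores` for reading: each row is a `Span` that a loop can traverse.
Table : ∀ {m n} → (ℕ → ℕ) → (ℕ → ℕ) → (Fin m → List (Fin n)) → Set
Table a b F = ∀ r → Span (λ q v → b q ≡ toℕ v) (a (toℕ r)) (F r) (a (suc (toℕ r)))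

array-table : ∀ {m n} (F : Fin m → List (Fin n)) → let xss = map (λ i → map toℕ (F i)) (allFin m) in
  Table (array (offsets 0 xss)) (array (concat xss)) F
array-table F r rewrite map-tabulate id (λ i → map toℕ (F i)) = span-map⁻ (F r) (go _ (span-array _) r)
  where
  -- The start `o` is general because the remaining rows begin after row zero.
  go : ∀ {f m o e} (L : Fin m → List ℕ) → Span (Entry f) o (concat (tabulate L)) e → ∀ r →
    Span (Entry f) (array (offsets o (tabulate L)) (toℕ r)) (L r) (array (offsets o (tabulate L)) (suc (toℕ r)))
  go {m = suc m} L s zero with span-++⁻ (L zero) s
  ... | l , s₁ , _ = subst (Span _ _ (L zero)) (trans (span-length s₁) (sym (head-offset (tabulate (L ∘ suc))))) s₁
    where
    head-offset : ∀ {o} xss → array (offsets o xss) 0 ≡ o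
    head-offset []        = refl
    head-offset (_ ∷ _)   = refl
  go {m = suc m} L s (suc r) with span-++⁻ (L zero) s
  ... | l , s₁ , s₂ rewrite span-length s₁ = go (L ∘ suc) s₂ r

table-kept : ∀ a b {c σ σ′ m n} {F : Fin m → List (Fin n)} → Unchanged c σ σ′ → {T (keepsArr a c)} → {T (keepsArr b c)} →
  Table (arr σ a) (arr σ b) F → Table (arr σ′ a) (arr σ′ b) F
table-kept a b {F = F} u {ka} {kb} = subst₂ (λ f g → Table f g F) (sym (arr= u a {ka})) (sym (arr= u b {kb}))

each : (a r q e : ℕ) → Cmd → Cmd
each a r q e c = q ≔ read a (var r) ﹔ e ≔ read a (var r ⊕ lit 1) ﹔ loop q e c

module _ {m n : ℕ} {F : Fin m → List (Fin n)} (b : ℕ) {a r q e : ℕ} {c : Cmd}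
  -- The factor `∧ true` in `k-b` is contributed by the increment of `q` at the end of the loop
  -- body.
  {k-q : T (keepsReg q c)} {k-e : T (keepsReg e c)} {k-b : T (keepsArr b c ∧ true)}
  {q≢e : T (not (q ≡ᵇ e))} {e≢q : T (not (e ≡ᵇ q))} {q≢r : T (not (q ≡ᵇ r))}
  (I : List (Fin n) → State → Set) (f : Fin n → ℕ) {σ : State} (ρ : Fin m) where

  private
    σ₁ = setReg q (⟦ read a (var r) ⟧ σ) σ
    σ₂ = setReg e (⟦ read a (var r ⊕ lit 1) ⟧ σ₁) σ₁

  -- The constant 8 pays for fetching the two offsets, at cost 3 and 5. The body receives frame
  -- information relative to the state before these fetches.
  run-each : Table (arr σ a) (arr σ b) F → reg σ r ≡ toℕ ρ → I (F ρ) σ₂ →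
    (∀ {x xs σ′} → Unchanged (each a r q e c) σ σ′ → arr σ′ b (reg σ′ q) ≡ toℕ x → I (x ∷ xs) σ′ →
      Run c σ′ (f x) (λ σ″ → I xs (setReg q (reg σ″ q + 1) σ″))) →
    Run (each a r q e c) σ (8 + loopTime f (F ρ)) (I [])
  run-each tab r= inv body = then-reg (then-reg
    (run-loop {At = λ j x → arr σ b j ≡ toℕ x} {k-i = k-q} {k-e = k-e} {i≢e = q≢e} I f body′ {F ρ} span inv))
    where
    q= : reg σ₂ q ≡ arr σ a (toℕ ρ)
    q= = trans (update-other (reg σ₁) e _ q e≢q) (trans (update-same (reg σ) q _) (cong (arr σ a) r=))
    -- The second offset is fetched after `q` has been assigned; `q≢r` ensures that the row index is
    -- still intact.
    e= : reg σ₂ e ≡ arr σ a (suc (toℕ ρ))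
    e= = trans (update-same (reg σ₁) e _) (cong (arr σ a)
      (trans (cong (_+ 1) (trans (update-other (reg σ) q _ r q≢r) r=)) (+-comm (toℕ ρ) 1)))
    span : Span (λ j x → arr σ b j ≡ toℕ x) (reg σ₂ q) (F ρ) (reg σ₂ e)
    span = subst₂ (λ i l → Span _ i (F ρ) l) (sym q=) (sym e=) (tab ρ)
    extend : ∀ {σ′} → Unchanged (loop q e c) σ₂ σ′ → Unchanged (each a r q e c) σ σ′
    extend u = record
      { reg= = λ x {k} →
          let k₁ = ∧-fst (not (q ≡ᵇ x)) k ; k₂₃ = ∧-snd (not (q ≡ᵇ x)) k
              k₂ = ∧-fst (not (e ≡ᵇ x)) k₂₃ ; k₃ = ∧-snd (not (e ≡ᵇ x)) k₂₃
          in trans (reg= u x {k₃}) (trans (update-other (reg σ₁) e _ x k₂) (update-other (reg σ) q _ x k₁))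
      ; arr= = λ y {k} → arr= u y {k} }
    body′ : ∀ {x xs σ′} → Unchanged (loop q e c) σ₂ σ′ → arr σ b (reg σ′ q) ≡ toℕ x → I (x ∷ xs) σ′ →
      Run c σ′ (f x) (λ σ″ → I xs (setReg q (reg σ″ q + 1) σ″))
    body′ {σ′ = σ′} u a≡ = body (extend u) (trans (cong (λ g → g (reg σ′ q)) (arr= u b {k-b})) a≡)

-- Marking sets of vertices by stamps.

-- M lists what is still to be stamped; entries below s are stale stamps of earlier rows.
record Pending {n} (s : ℕ) (m : ℕ → ℕ) (L M : List (Fin n)) : Set where
  constructor pending
  field
    bounded : ∀ v → m v ≤ s
    sound   : ∀ {v} → s ≤ m (toℕ v) ⊎ v ∈ M → v ∈ L
    covers  : ∀ {v} → v ∈ L → s ≤ m (toℕ v) ⊎ v ∈ M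

-- Strictness makes the stamp fresh: no old mark reaches `s`, so all of `L` is still pending.
pending-start : ∀ {n s m} {L : List (Fin n)} → (∀ v → m v < s) → Pending s m L L
pending-start fresh = pending (<⇒≤ ∘ fresh) [ (λ s≤ → ⊥-elim (<⇒≱ (fresh _) s≤)) , id ]′ inj₂

pending-stamp : ∀ {n s m i} {L M : List (Fin n)} {x} → i ≡ toℕ x → Pending s m L (x ∷ M) → Pending s (update m i s) L M
pending-stamp {s = s} {m} {L = L} {M} {x} refl (pending bounded sound covers) = pending bounded′ sound′ covers′
  where
  bounded′ : ∀ v → update m (toℕ x) s v ≤ s
  bounded′ v with toℕ x ≡ᵇ v
  ... | true  = ≤-refl
  ... | false = bounded v
  other : ∀ {v} → x ≢ v → update m (toℕ x) s (toℕ v) ≡ m (toℕ v)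
  other {v} x≢v = update-other m (toℕ x) s (toℕ v) (≢⇒not≡ᵇ (x≢v ∘ toℕ-injective))
  sound′ : ∀ {v} → s ≤ update m (toℕ x) s (toℕ v) ⊎ v ∈ M → v ∈ L
  sound′ {v} h with x ≟ v
  ... | yes refl = sound (inj₂ (here refl))
  ... | no x≢v   = sound ([ inj₁ ∘ subst (s ≤_) (other x≢v) , inj₂ ∘ there ]′ h)
  covers′ : ∀ {v} → v ∈ L → s ≤ update m (toℕ x) s (toℕ v) ⊎ v ∈ M
  covers′ {v} v∈ with x ≟ v
  ... | yes refl = inj₁ (≤-reflexive (sym (update-same m (toℕ x) s)))
  ... | no x≢v with covers v∈
  ...   | inj₁ s≤         = inj₁ (subst (s ≤_) (sym (other x≢v)) s≤)
  ...   | inj₂ (here v≡x) = ⊥-elim (x≢v (sym v≡x))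
  ...   | inj₂ (there v∈) = inj₂ v∈

-- The program

-- Registers; the only array besides input and output is marks.
pattern ∣J∣     = 1
pattern ∣T∣     = 2
pattern rowEnd  = 3
pattern row     = 4
pattern stamp   = 5
pattern pos     = 6
pattern item    = 7
pattern found   = 8
pattern ptr     = 9
pattern ptrEnd  = 10
pattern vtx     = 11
pattern ptr′    = 12
pattern ptr′End = 13

pattern marks   = 14

markBag : Cmd
markBag = each X-offset row ptr ptrEnd (marks [ read X-elem (var ptr) ]≔ var stamp)

markClosedNbhd : Cmd
markClosedNbhd = each H-offset row ptr ptrEnd
  ( vtx ≔ read H-vertex (var ptr)
  ﹔ marks [ var vtx ]≔ var stamp
  ﹔ each G-offset vtx ptr′ ptr′End (marks [ read G-nbr (var ptr′) ]≔ var stamp))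

-- The output arrays are 10 + x and 11 + x (x = 0 for G(𝓗), x = 2 for the bags): in this form they
-- are seen by computation to differ from the input arrays.  For d = 0 the row's own index is skipped.
scan : (x d : ℕ) → Cmd
scan x d = item ≔ lit 0 ﹔ loop item ∣J∣
  ( found ≔ lit 0
  ﹔ each H-offset item ptr ptrEnd (ifnz (var stamp ⊖ read marks (read H-vertex (var ptr))) skip (found ≔ lit 1))
  ﹔ ifnz (lit d ⊕ ((var item ⊖ var row) ⊕ (var row ⊖ var item)))
      (ifnz (var found) ((11 + x) [ var pos ]≔ var item ﹔ pos ≔ var pos ⊕ lit 1) skip)
      skip)

-- After the scan, `pos` is the end of the row just written, hence the offset with index `row + 1`;
-- offset zero is set by `outputRows`.
outputRow : (x d : ℕ) → Cmd → Cmd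
outputRow x d mark = stamp ≔ var stamp ⊕ lit 1 ﹔ mark ﹔ scan x d ﹔ (10 + x) [ var row ⊕ lit 1 ]≔ var pos

outputRows : (x d : ℕ) → ℕ → Cmd → Cmd
outputRows x d m mark =
  rowEnd ≔ var m ﹔ row ≔ lit 0 ﹔ pos ≔ lit 0 ﹔ (10 + x) [ lit 0 ]≔ lit 0 ﹔ loop row rowEnd (outputRow x d mark)

-- The case of no subgraphs is treated apart because the time bound is then constant and leaves no
-- time for visiting the nodes of the tree. The zeros initially in the output arrays are already the
-- right offsets.
program : Cmd
program = ifnz (var ∣J∣) (outputRows 0 0 ∣J∣ markClosedNbhd ﹔ outputRows 2 1 ∣T∣ markBag) skip

-- Correctness and cost of marking, scanning and writing rows.

Stamped : ∀ {n} → State → List (Fin n) → Set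
Stamped σ L = Pending (reg σ stamp) (arr σ marks) L []

stamped-kept : ∀ {c σ σ′ n} {L : List (Fin n)} → Unchanged c σ σ′ → {T (keepsReg stamp c)} → {T (keepsArr marks c)} →
  Stamped σ L → Stamped σ′ L
stamped-kept {L = L} u {k₁} {k₂} = subst₂ (λ s m → Pending s m L []) (sym (reg= u stamp {k₁})) (sym (arr= u marks {k₂}))

-- The instruction costs of scan and outputRows added up, with |V(H i)| ≤ n and b bounding the cost of mark.
scanTime : ℕ → ℕ → ℕ
scanTime n k = 2 + (k * (8 + (2 + ((8 + (n * 16 + 4)) + 19))) + 4)

rowsTime : ℕ → ℕ → ℕ → ℕ → ℕ
rowsTime n k m b = 9 + (m * (8 + (4 + (b + (scanTime n k + 5)))) + 4)

module _ {n k p : ℕ} (gs : Fin n → List (Fin n)) (xs : Fin p → List (Fin n)) (hs : Fin k → List (Fin n)) where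

  Loaded : State → Set
  Loaded σ = reg σ ∣J∣ ≡ k × Table (arr σ G-offset) (arr σ G-nbr) gs × Table (arr σ X-offset) (arr σ X-elem) xs
    × Table (arr σ H-offset) (arr σ H-vertex) hs

  keepsLoaded : Cmd → Bool
  keepsLoaded c = keepsReg ∣J∣ c ∧ keepsArr G-offset c ∧ keepsArr G-nbr c ∧ keepsArr X-offset c ∧ keepsArr X-elem c
    ∧ keepsArr H-offset c ∧ keepsArr H-vertex c

  loaded-kept : ∀ {c σ σ′} → Unchanged c σ σ′ → {T (keepsLoaded c)} → Loaded σ → Loaded σ′
  loaded-kept {c} u {k₀} (j= , G , X , H) =
    trans (reg= u ∣J∣ {∧-fst (keepsReg ∣J∣ c) k₀}) j=
    , table-kept G-offset G-nbr u {∧-fst (keepsArr G-offset c) k₁} {∧-fst (keepsArr G-nbr c) k₂} G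
    , table-kept X-offset X-elem u {∧-fst (keepsArr X-offset c) k₃} {∧-fst (keepsArr X-elem c) k₄} X
    , table-kept H-offset H-vertex u {∧-fst (keepsArr H-offset c) k₅} {∧-snd (keepsArr H-offset c) k₅} H
    where
    k₁ = ∧-snd (keepsReg ∣J∣ c) k₀
    k₂ = ∧-snd (keepsArr G-offset c) k₁
    k₃ = ∧-snd (keepsArr G-nbr c) k₂
    k₄ = ∧-snd (keepsArr X-offset c) k₃
    k₅ = ∧-snd (keepsArr X-elem c) k₄

  run-markBag : ∀ {σ} t → Loaded σ → reg σ row ≡ toℕ t → (∀ v → arr σ marks v < reg σ stamp) →
    Run markBag σ (8 + loopTime (λ _ → 4) (xs t)) (λ σ′ → Stamped σ′ (xs t))
  run-markBag t (_ , _ , X , _) row= fresh = run-each X-elem (λ M σ → Pending (reg σ stamp) (arr σ marks) (xs t) M) (λ _ → 4)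
    t X row= (pending-start fresh) (λ u at inv → run-arr (pending-stamp at inv))

  closedNbhds : Fin k → List (Fin n)
  closedNbhds j = concatMap (λ v → v ∷ gs v) (hs j)

  -- Per vertex, 14 is 3 for fetching it, 3 for stamping it and 8 for opening its adjacency list;
  -- stamping a neighbour costs 4.
  run-markClosedNbhd : ∀ {σ} j → Loaded σ → reg σ row ≡ toℕ j → (∀ v → arr σ marks v < reg σ stamp) →
    Run markClosedNbhd σ (8 + loopTime (λ v → 14 + loopTime (λ _ → 4) (gs v)) (hs j)) (λ σ′ → Stamped σ′ (closedNbhds j))
  run-markClosedNbhd j (_ , G , _ , H) row= fresh = run-each H-vertex
    (λ M σ → Pending (reg σ stamp) (arr σ marks) (closedNbhds j) (concatMap (λ v → v ∷ gs v) M)) _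
    j H row= (pending-start fresh)
    (λ {v} {vs} u at inv → then-reg (then-arr (run-each G-nbr
      -- The inner invariant appends what the outer loop has still to stamp, so that entering and
      -- leaving the inner loop requires no conversion.
      (λ M σ → Pending (reg σ stamp) (arr σ marks) (closedNbhds j) (M ++ concatMap (λ v → v ∷ gs v) vs)) (λ _ → 4)
      v (table-kept G-offset G-nbr u G) at (pending-stamp at inv) (λ _ at inv → run-arr (pending-stamp at inv)))))

  module _ {x d : ℕ} {k-marks : T (keepsArr marks (scan x d))} (hs≤n : ∀ i → length (hs i) ≤ n)
    {L : List (Fin n)} (r : ℕ) {P : Fin k → Set} (P? : ∀ i → Dec (P i))
    (hit : ∀ i → (d + ((toℕ i ∸ r) + (r ∸ toℕ i)) ≢ 0 × Any (_∈ L) (hs i)) ⇔ P i) where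

    -- `done` also contains the rows written earlier. The final contents `total` stay fixed while
    -- elements move from the filtered remainder to `done`.
    Emitted : List ℕ → List (Fin k) → State → Set
    Emitted total is σ = Σ[ done ∈ List ℕ ] (done ++ map toℕ (filter P? is) ≡ total × Span (Entry (arr σ (11 + x))) 0 done (reg σ pos))

    emit : ∀ {total i is σ} → P i → reg σ item ≡ toℕ i → Emitted total (i ∷ is) σ →
      Emitted total is (setReg pos (reg σ pos + 1) (setArr (11 + x) (reg σ pos) (reg σ item) σ))
    emit {total} {i} {is} {σ} pi item= (done , eq , span) = done ∷ʳ toℕ i , eq′ ,
      subst₂ (λ f l → Span (Entry f) 0 (done ∷ʳ toℕ i) l) (sym (update-same (arr σ) (11 + x) _)) (+-comm 1 (reg σ pos))
        (subst (λ y → Span (Entry (update (arr σ (11 + x)) (reg σ pos) (reg σ item))) 0 (done ∷ʳ y) (suc (reg σ pos)))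
          item= (span-append span))
      where
      eq′ : (done ∷ʳ toℕ i) ++ map toℕ (filter P? is) ≡ total
      eq′ = trans (++-assoc done _ _) (trans (cong (λ l → done ++ map toℕ l) (sym (filter-accept P? pi))) eq)

    omit : ∀ {total i is σ} → ¬ P i → Emitted total (i ∷ is) σ → Emitted total is σ
    omit ¬pi (done , eq , span) = done , trans (cong (λ l → done ++ map toℕ l) (sym (filter-reject P? ¬pi))) eq , span

    emitted-kept : ∀ {c σ σ′ total is} → Unchanged c σ σ′ → {T (keepsArr (11 + x) c)} → {T (keepsReg pos c)} →
      Emitted total is σ → Emitted total is σ′
    emitted-kept u {k₁} {k₂} (done , eq , span) = done , eq ,
      subst₂ (λ f l → Span (Entry f) 0 done l) (sym (arr= u (11 + x) {k₁})) (sym (reg= u pos {k₂})) span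

    -- Per index, 2 resets `found`, 8 opens the vertex list, and 19 bounds the final tests together
    -- with the append. A single vertex test costs at most 8.
    run-scan : ∀ {σ total} → Loaded σ → reg σ row ≡ r → Stamped σ L → Emitted total (allFin k) σ →
      Run (scan x d) σ (scanTime n k) (Emitted total [])
    run-scan {σ} {total} (j= , _ , _ , H) row= stamped inv = then-reg (within
      (loopTime-≤ _ k (λ i → +-monoʳ-≤ 2 (+-monoˡ-≤ 19 (+-monoʳ-≤ 8 (loopTime-≤ 8 n (λ _ → ≤-refl) (hs i) (hs≤n i)))))
        (allFin k) (≤-reflexive (length-tabulate id)))
      (run-loop {At = λ i x → i ≡ toℕ x} (Emitted total) (λ i → 2 + ((8 + loopTime (λ _ → 8) (hs i)) + 19)) body
        (subst (Span _ 0 (allFin k)) (sym j=) (span-allFin k)) inv))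
      where
      body : ∀ {i is σ₁} → Unchanged _ (setReg item 0 σ) σ₁ → reg σ₁ item ≡ toℕ i → Emitted total (i ∷ is) σ₁ →
        Run _ σ₁ (2 + ((8 + loopTime (λ _ → 8) (hs i)) + 19)) (λ σ₂ → Emitted total is (setReg item (reg σ₂ item + 1) σ₂))
      body {i} {is} {σ₁} u item= out = then-reg (run-seq
        (run-each H-vertex Found (λ _ → 8) i (table-kept H-offset H-vertex u H) item=
          (mk⇔ [ (λ 0≢0 → ⊥-elim (0≢0 refl)) , id ]′ inj₂) look)
        finish)
        where
        -- A hit is either recorded or still ahead. Once `vs` is empty, `found` alone decides
        -- whether `H i` meets the stamped set.
        Found : List (Fin n) → State → Set
        Found vs σ = (reg σ found ≢ 0 ⊎ Any (_∈ L) vs) ⇔ Any (_∈ L) (hs i)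

        look : ∀ {v vs σ₂} → Unchanged _ (setReg found 0 σ₁) σ₂ → arr σ₂ H-vertex (reg σ₂ ptr) ≡ toℕ v → Found (v ∷ vs) σ₂ →
          Run (ifnz (var stamp ⊖ read marks (read H-vertex (var ptr))) skip (found ≔ lit 1)) σ₂ 8
            (λ σ₃ → Found vs (setReg ptr (reg σ₃ ptr + 1) σ₃))
        look {v} {vs} {σ₂} u₂ at inv = run-ifnz
          -- A nonzero truncated difference means that the mark lies below the stamp, so `v` is not
          -- in `L` and a hit in `v ∷ vs` is one in `vs`.
          (λ ≢0 → within (s≤s z≤n) (run-skip (mk⇔
            (to inv ∘ [ inj₁ , inj₂ ∘ there ]′)
            (λ any → [ inj₁ , (λ { (here v∈) → ⊥-elim (≢0 (m≤n⇒m∸n≡0 (stamped⁺ v∈))) ; (there a) → inj₂ a }) ]′ (from inv any)))))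
          (λ ≡0 → run-reg (mk⇔
            (λ _ → to inv (inj₂ (here (Pending.sound stamped₂ (inj₁ (subst (λ w → reg σ₂ stamp ≤ arr σ₂ marks w) at (m∸n≡0⇒m≤n ≡0)))))))
            (λ _ → inj₁ λ ())))
          where
          stamped₂ : Stamped σ₂ L
          stamped₂ = stamped-kept u₂ (stamped-kept u {_} {k-marks} stamped)
          stamped⁺ : v ∈ L → reg σ₂ stamp ≤ arr σ₂ marks (arr σ₂ H-vertex (reg σ₂ ptr))
          stamped⁺ v∈ with Pending.covers stamped₂ v∈
          ... | inj₁ s≤ = subst (λ w → reg σ₂ stamp ≤ arr σ₂ marks w) (sym at) s≤

        finish : ∀ {σ₂} → Unchanged _ (setReg found 0 σ₁) σ₂ → Found [] σ₂ →
          Run (ifnz (lit d ⊕ ((var item ⊖ var row) ⊕ (var row ⊖ var item)))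
            (ifnz (var found) ((11 + x) [ var pos ]≔ var item ﹔ pos ≔ var pos ⊕ lit 1) skip) skip) σ₂ 19
            (λ σ₃ → Emitted total is (setReg item (reg σ₃ item + 1) σ₃))
        finish {σ₂} u₂ fnd = run-ifnz
          (λ sel → run-ifnz
            (λ ≢0 → then-arr (run-reg (emit {σ = σ₂} (to (hit i) (subst (_≢ 0) sel= sel , to fnd (inj₁ ≢0))) item₂ out₂)))
            (λ ≡0 → within (s≤s z≤n) (run-skip (omit {σ = σ₂} (λ pi → [ (λ ≢0 → ≢0 ≡0) , (λ ()) ]′ (from fnd (proj₂ (from (hit i) pi)))) out₂))))
          (λ unsel → within (s≤s z≤n) (run-skip (omit {σ = σ₂} (λ pi → proj₁ (from (hit i) pi) (trans (sym sel=) unsel)) out₂)))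
          where
          item₂ : reg σ₂ item ≡ toℕ i
          item₂ = trans (reg= u₂ item) item=
          out₂ : Emitted total (i ∷ is) σ₂
          out₂ = emitted-kept u₂ out
          sel= : d + ((reg σ₂ item ∸ reg σ₂ row) + (reg σ₂ row ∸ reg σ₂ item)) ≡ d + ((toℕ i ∸ r) + (r ∸ toℕ i))
          sel= = cong₂ (λ y z → d + ((y ∸ z) + (z ∸ y))) item₂ (trans (reg= u₂ row) (trans (reg= u row) row=))

module _ {n k p : ℕ} (gs : Fin n → List (Fin n)) (xs : Fin p → List (Fin n)) (hs : Fin k → List (Fin n)) where

  module _ (x d : ℕ) {m : ℕ} (mark : Cmd)
    {x-marks : T (keepsArr marks (scan x d))} {x-off : T (keepsArr (10 + x) (scan x d))}
    {off-marks : T (not (10 + x ≡ᵇ marks))} {off-elem : T (not (10 + x ≡ᵇ 11 + x))}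
    {mark-loaded : T (keepsLoaded gs xs hs mark)}
    {mark-end : T (keepsReg rowEnd mark)} {mark-row : T (keepsReg row mark)} {mark-pos : T (keepsReg pos mark)}
    {mark-off : T (keepsArr (10 + x) mark)} {mark-elem : T (keepsArr (11 + x) mark)}
    {body-end : T (keepsReg rowEnd (outputRow x d mark))} {body-row : T (keepsReg row (outputRow x d mark))}
    (hs≤n : ∀ i → length (hs i) ≤ n)
    {L : Fin m → List (Fin n)} {b : ℕ}
    (run-mark : ∀ {σ} r → Loaded gs xs hs σ → reg σ row ≡ toℕ r → (∀ v → arr σ marks v < reg σ stamp) →
      Run mark σ b (λ σ′ → Stamped σ′ (L r)))
    {P : Fin m → Fin k → Set} (P? : ∀ r i → Dec (P r i))
    (hit : ∀ r i → (d + ((toℕ i ∸ toℕ r) + (toℕ r ∸ toℕ i)) ≢ 0 × Any (_∈ L r) (hs i)) ⇔ P r i) where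

    outRow : Fin m → List ℕ
    outRow r = map toℕ (filter (P? r) (allFin k))

    -- There is one more offset than rows, hence `suc rws`.
    Written : List (List ℕ) → ℕ → State → Set
    Written xss rws σ = Span (Entry (arr σ (11 + x))) 0 (concat xss) (reg σ pos)
      × Span (Entry (arr σ (10 + x))) 0 (offsets 0 xss) (suc rws)

    -- The weak bound on the marks becomes strict when the stamp is incremented. It holds again
    -- after the last row, so the second table can reuse the marks of the first.
    Ready : State → Set
    Ready σ = Loaded gs xs hs σ × (∀ v → arr σ marks v ≤ reg σ stamp)

    Inv : List (Fin m) → State → Set
    Inv rs σ = Ready σ × Σ[ done ∈ List (List ℕ) ] (done ++ map outRow rs ≡ map outRow (allFin m) × Written done (reg σ row) σ)

    private
      -- The 4 increments the stamp and the 5 stores the offset.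
      rowTime = 4 + (b + (scanTime n k + 5))

    run-outputRow : ∀ {r rs σ} → reg σ row ≡ toℕ r → Inv (r ∷ rs) σ →
      Run (outputRow x d mark) σ rowTime (λ σ′ → Inv rs (setReg row (reg σ′ row + 1) σ′))
    run-outputRow {r} {rs} {σ} row= ((loaded , bounded) , done , eq , elem , off) =
      then-reg (run-seq (run-mark r loaded row= fresh) λ {σ₁} u₁ stamped →
        run-seq
          (run-scan gs xs hs {x} {d} {x-marks} hs≤n (toℕ r) (P? r) (hit r) {σ₁} {concat done ++ outRow r}
            (loaded-kept gs xs hs u₁ {mark-loaded} loaded)
            (trans (reg= u₁ row {mark-row}) row=)
            stamped
            (concat done , refl ,
              subst₂ (λ f l → Span (Entry f) 0 (concat done) l) (sym (arr= u₁ (11 + x) {mark-elem})) (sym (reg= u₁ pos {mark-pos})) elem))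
          λ {σ₂} u₂ out → run-arr (finish u₁ stamped u₂ out))
      where
      σ₀ = setReg stamp (reg σ stamp + 1) σ

      fresh : ∀ v → arr σ marks v < reg σ stamp + 1
      fresh v = ≤-trans (s≤s (bounded v)) (≤-reflexive (+-comm 1 (reg σ stamp)))

      finish : ∀ {σ₁ σ₂} → Unchanged mark σ₀ σ₁ → Stamped σ₁ (L r) → Unchanged (scan x d) σ₁ σ₂ →
        Emitted gs xs hs {x} {d} {x-marks} hs≤n (toℕ r) (P? r) (hit r) (concat done ++ outRow r) [] σ₂ →
        let σ₃ = setArr (10 + x) (reg σ₂ row + 1) (reg σ₂ pos) σ₂ in Inv rs (setReg row (reg σ₃ row + 1) σ₃)
      finish {σ₁} {σ₂} u₁ stamped u₂ (full , full= , span) =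
        (loaded-kept gs xs hs u₂ (loaded-kept gs xs hs u₁ {mark-loaded} loaded) , bounded′) , done ∷ʳ outRow r ,
        trans (++-assoc done _ _) eq , elem′ , off′
        where
        σ₃ = setArr (10 + x) (reg σ₂ row + 1) (reg σ₂ pos) σ₂

        bounded′ : ∀ v → arr σ₃ marks v ≤ reg σ₂ stamp
        bounded′ v = subst (λ f → f v ≤ reg σ₂ stamp) (sym (update-other (arr σ₂) (10 + x) _ marks off-marks))
          (Pending.bounded (stamped-kept u₂ {_} {x-marks} stamped) v)

        span′ : Span (Entry (arr σ₂ (11 + x))) 0 (concat (done ∷ʳ outRow r)) (reg σ₂ pos)
        span′ = subst (λ l → Span _ 0 l (reg σ₂ pos))
          (trans (sym (++-identityʳ full)) (trans full= (sym (concat-∷ʳ done (outRow r))))) span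

        elem′ : Span (Entry (arr σ₃ (11 + x))) 0 (concat (done ∷ʳ outRow r)) (reg σ₂ pos)
        elem′ = subst (λ f → Span (Entry f) 0 (concat (done ∷ʳ outRow r)) (reg σ₂ pos))
          (sym (update-other (arr σ₂) (10 + x) _ (11 + x) off-elem)) span′

        off₂ : Span (Entry (arr σ₂ (10 + x))) 0 (offsets 0 done) (reg σ₂ row + 1)
        off₂ = subst₂ (λ f l → Span (Entry f) 0 (offsets 0 done) l)
          (sym (trans (arr= u₂ (10 + x) {x-off}) (arr= u₁ (10 + x) {mark-off})))
          (trans (+-comm 1 (reg σ row)) (cong (_+ 1) (sym (trans (reg= u₂ row) (reg= u₁ row {mark-row})))))
          off

        off′ : Span (Entry (arr σ₃ (10 + x))) 0 (offsets 0 (done ∷ʳ outRow r)) (suc (reg σ₂ row + 1))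
        off′ = subst₂ (λ f l → Span (Entry f) 0 l (suc (reg σ₂ row + 1)))
          (sym (update-same (arr σ₂) (10 + x) _))
          (trans (cong (offsets 0 done ∷ʳ_) (span-length span′)) (sym (offsets-∷ʳ 0 done (outRow r))))
          (span-append off₂)

    run-outputRows : ∀ {σ y} → Ready σ → reg σ y ≡ m →
      Run (outputRows x d y mark) σ (rowsTime n k m b) (λ σ′ → Ready σ′ × Stores σ′ (10 + x) (11 + x) (map outRow (allFin m)))
    run-outputRows {σ} {y} (loaded , bounded) y= = then-reg (then-reg (then-reg (then-arr
      (conclude stored (within (loopTime-≤ rowTime m (λ _ → ≤-refl) (allFin m) (≤-reflexive (length-tabulate id)))
        (run-loop {At = λ i r → i ≡ toℕ r} {k-i = body-row} {k-e = body-end} Inv (λ _ → rowTime)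
          (λ _ row= inv → run-outputRow row= inv)
          (subst (Span _ 0 (allFin m)) (sym y=) (span-allFin m))
          -- With no row written, the offsets consist of the single entry 0 that has just been
          -- stored.
          ((loaded , bounded′) , [] , refl , [] , off₀)))))))
      where
      σ₀ = setArr (10 + x) 0 0 σ

      bounded′ : ∀ v → arr σ₀ marks v ≤ reg σ stamp
      bounded′ v = subst (λ f → f v ≤ reg σ stamp) (sym (update-other (arr σ) (10 + x) _ marks off-marks)) (bounded v)

      off₀ : Span (Entry (arr σ₀ (10 + x))) 0 (0 ∷ []) 1
      off₀ = subst (λ f → Span (Entry f) 0 (0 ∷ []) 1) (sym (update-same (arr σ) (10 + x) _)) (refl ∷ [])

      stored : ∀ σ′ → Inv [] σ′ → Ready σ′ × Stores σ′ (10 + x) (11 + x) (map outRow (allFin m))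
      stored σ′ (ready , done , eq , elem , off) = ready ,
        subst (Stores σ′ (10 + x) (11 + x)) (trans (sym (++-identityʳ done)) eq) (span⇒Holds off , span⇒Holds elem)

-- Running time and correctness

-- Positivity of `k` and `n` absorbs every term into `k * n`, and 63 is 6 + 41 + 16. The factors 1
-- in the first step are the ones that get replaced.
scanTime-≤ : ∀ n k → 1 ≤ k → 1 ≤ n → scanTime n k ≤ 63 * (k * n)
scanTime-≤ n k 1≤k 1≤n = begin
  scanTime n k                              ≡⟨ eq n k ⟩
  6 * 1 + 41 * (k * 1) + 16 * (k * n)       ≤⟨ +-monoˡ-≤ (16 * (k * n)) (+-mono-≤
                                                 (*-monoʳ-≤ 6 (*-mono-≤ 1≤k 1≤n))
                                                 (*-monoʳ-≤ 41 (*-monoʳ-≤ k 1≤n))) ⟩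
  6 * (k * n) + 41 * (k * n) + 16 * (k * n) ≡⟨ eq′ (k * n) ⟩
  63 * (k * n)                              ∎
  where
  open ≤-Reasoning
  eq : ∀ n k → 2 + (k * (8 + (2 + ((8 + (n * 16 + 4)) + 19))) + 4) ≡ 6 * 1 + 41 * (k * 1) + 16 * (k * n)
  eq = solve-∀
  eq′ : ∀ z → 6 * z + 41 * z + 16 * z ≡ 63 * z
  eq′ = solve-∀

-- The leading 2 is the test for subgraphs. The constant 118 is the coefficient 29 + 26 + 63 of
-- `k * (k * n)`, the largest that occurs.
programTime-≤ : ∀ n k p m → 1 ≤ k → 1 ≤ n →
  2 + (rowsTime n k k (12 + (26 * n + 24 * m)) + rowsTime n k p (8 + (n * 12 + 4))) ≤ 118 * (1 + k * ((k + p) * n + m))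
programTime-≤ n k p m 1≤k 1≤n = begin
  2 + (rowsTime n k k (12 + (26 * n + 24 * m)) + rowsTime n k p (8 + (n * 12 + 4)))
    ≡⟨ eq n k p m (scanTime n k) ⟩
  28 + (k * (29 * 1 + 26 * (1 * n) + scanTime n k + 24 * m) + p * (29 * 1 + 12 * (1 * n) + scanTime n k))
    ≤⟨ +-monoʳ-≤ 28 (+-mono-≤
         (*-monoʳ-≤ k (+-monoˡ-≤ (24 * m) (+-mono-≤ (+-mono-≤ (*-monoʳ-≤ 29 1≤kn) (*-monoʳ-≤ 26 n≤kn)) scan≤)))
         (*-monoʳ-≤ p (+-mono-≤ (+-mono-≤ (*-monoʳ-≤ 29 1≤kn) (*-monoʳ-≤ 12 n≤kn)) scan≤))) ⟩
  28 + (k * (29 * (k * n) + 26 * (k * n) + 63 * (k * n) + 24 * m) + p * (29 * (k * n) + 12 * (k * n) + 63 * (k * n)))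
    -- The padding raises the remaining coefficients to 118: from 28 for the constant, 24 for
    -- `k * m` and 104 for `p * (k * n)`.
    ≤⟨ m≤m+n _ (90 + (94 * (k * m) + 14 * (p * (k * n)))) ⟩
  28 + (k * (29 * (k * n) + 26 * (k * n) + 63 * (k * n) + 24 * m) + p * (29 * (k * n) + 12 * (k * n) + 63 * (k * n)))
    + (90 + (94 * (k * m) + 14 * (p * (k * n))))
    ≡⟨ eq′ n k p m ⟩
  118 * (1 + k * ((k + p) * n + m)) ∎
  where
  open ≤-Reasoning
  1≤kn : 1 ≤ k * n
  1≤kn = *-mono-≤ 1≤k 1≤n
  n≤kn : 1 * n ≤ k * n
  n≤kn = *-monoˡ-≤ n 1≤k
  scan≤ = scanTime-≤ n k 1≤k 1≤n
  eq : ∀ n k p m s → 2 + ((9 + (k * (8 + (4 + ((12 + (26 * n + 24 * m)) + (s + 5)))) + 4)) + (9 + (p * (8 + (4 + ((8 + (n * 12 + 4)) + (s + 5)))) + 4)))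
    ≡ 28 + (k * (29 * 1 + 26 * (1 * n) + s + 24 * m) + p * (29 * 1 + 12 * (1 * n) + s))
  eq = solve-∀
  eq′ : ∀ n k p m →
    28 + (k * (29 * (k * n) + 26 * (k * n) + 63 * (k * n) + 24 * m) + p * (29 * (k * n) + 12 * (k * n) + 63 * (k * n)))
      + (90 + (94 * (k * m) + 14 * (p * (k * n)))) ≡ 118 * (1 + k * ((k + p) * n + m))
  eq′ = solve-∀

∸-distance≡0 : ∀ {m n} → (m ∸ n) + (n ∸ m) ≡ 0 → m ≡ n
∸-distance≡0 {m} {n} eq = ≤-antisym (m∸n≡0⇒m≤n (m+n≡0⇒m≡0 (m ∸ n) eq)) (m∸n≡0⇒m≤n (m+n≡0⇒n≡0 (m ∸ n) eq))

-- Over `Fin 0` all rows are empty, so every offset is 0 and there are no elements to store.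
stores-empty : ∀ σ a b {k m} (F : Fin m → List (Fin k)) → k ≡ 0 → (∀ i → arr σ a i ≡ 0) →
  Stores σ a b (map (λ i → map toℕ (F i)) (allFin m))
stores-empty σ a b {m = m} F refl zeros =
  (λ i → trans (zeros (toℕ i)) (sym (zero-offsets (allFin m) i))) , λ i → ⊥-elim (no-entry (allFin m) i)
  where
  zero-offsets : ∀ is i → lookup (offsets 0 (map (λ i → map toℕ (F i)) is)) i ≡ 0
  zero-offsets []       zero    = refl
  zero-offsets (_ ∷ _)  zero    = refl
  zero-offsets (j ∷ js) (suc i) with F j
  ... | [] = zero-offsets js i
  no-entry : ∀ is → ¬ Fin (length (concat (map (λ i → map toℕ (F i)) is)))
  no-entry (j ∷ js) i with F j
  ... | [] = no-entry js i

stores-kept : ∀ a b xss {c σ σ′} → Unchanged c σ σ′ → {T (keepsArr a c)} → {T (keepsArr b c)} →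
  Stores σ a b xss → Stores σ′ a b xss
stores-kept a b xss u {ka} {kb} = subst₂ (λ f f′ → Holds f (offsets 0 xss) × Holds f′ (concat xss))
  (sym (arr= u a {ka})) (sym (arr= u b {kb}))

-- A vertex costs 8 + 14 + 4 = 26 and a neighbour 8 + 4 = 12; the bound `2 * m` on the degree sum
-- turns 12 into 24.
markTime-≤ : ∀ {n l m} (gs : Fin n → List (Fin n)) vs → length vs ≤ l → sum (map (length ∘ gs) vs) ≤ 2 * m →
  8 + loopTime (λ v → 14 + loopTime (λ _ → 4) (gs v)) vs ≤ 12 + (26 * l + 24 * m)
markTime-≤ {l = l} {m} gs vs ≤l ≤2m = begin
  8 + loopTime (λ v → 14 + loopTime (λ _ → 4) (gs v)) vs       ≤⟨ +-monoʳ-≤ 8 (+-monoˡ-≤ 4 (go vs)) ⟩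
  8 + (26 * length vs + 12 * sum (map (length ∘ gs) vs) + 4)   ≤⟨ +-monoʳ-≤ 8 (+-monoˡ-≤ 4 (+-mono-≤ (*-monoʳ-≤ 26 ≤l) (*-monoʳ-≤ 12 ≤2m))) ⟩
  8 + (26 * l + 12 * (2 * m) + 4)                              ≡⟨ eq l m ⟩
  12 + (26 * l + 24 * m)                                       ∎
  where
  open ≤-Reasoning
  eq : ∀ l m → 8 + (26 * l + 12 * (2 * m) + 4) ≡ 12 + (26 * l + 24 * m)
  eq = solve-∀
  step : ∀ a l s → 8 + (14 + (a * 12 + 4)) + (26 * l + 12 * s) ≡ 26 * (1 + l) + 12 * (a + s)
  step = solve-∀
  go : ∀ vs → sum (map (λ v → 8 + (14 + loopTime (λ _ → 4) (gs v))) vs) ≤ 26 * length vs + 12 * sum (map (length ∘ gs) vs)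
  go []       = z≤n
  go (v ∷ vs) = ≤-trans
    (+-mono-≤ (+-monoʳ-≤ 22 (loopTime-≤ 4 _ (λ _ → ≤-refl) (gs v) ≤-refl)) (go vs))
    (≤-reflexive (step (length (gs v)) (length vs) _))

module _ {n k p : ℕ} (G : Graph n) (H : Fin k → Subgraph G) (T : Graph p) (X : Fin p → Subset n)
  (nonnull : ∀ j → Nonempty (Subgraph.V (H j)))
  (g : AdjacencyLists G) (h : ∀ j → SubgraphLists (H j)) (t : AdjacencyLists T) (x : BagLists X) where

  open Graph G
  open Graph (G ⟨ H ⟩) using () renaming (_∼_ to _≈_; _∼?_ to _≈?_)

  private
    gs = λ v → elems (g v)
    xs = λ t → elems (x t)
    hs = λ j → elems (SubgraphLists.vertices (h j))
    σ₀ = input G H T X g h t x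

  hs⁺ : ∀ {j v} → v ∈ˢ Subgraph.V (H j) → v ∈ hs j
  hs⁺ {j} = Listing.complete (SubgraphLists.vertices (h j))

  hs⁻ : ∀ {j v} → v ∈ hs j → v ∈ˢ Subgraph.V (H j)
  hs⁻ {j} = Listing.sound (SubgraphLists.vertices (h j))

  meets-closedNbhds : ∀ j i →
    (((toℕ i ∸ toℕ j) + (toℕ j ∸ toℕ i)) ≢ 0 × Any (_∈ closedNbhds gs xs hs j) (hs i)) ⇔ (j ≈ i)
  meets-closedNbhds j i = mk⇔
    (λ (≢0 , any) → (λ { refl → ≢0 (cong₂ _+_ (n∸n≡0 (toℕ i)) (n∸n≡0 (toℕ i))) }) , touch any)
    (λ (j≢i , touch) → (λ ≡0 → j≢i (sym (toℕ-injective (∸-distance≡0 ≡0)))) , any touch)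
    where
    touch : Any (_∈ closedNbhds gs xs hs j) (hs i) →
      (∃[ v ] (v ∈ˢ Subgraph.V (H j) × v ∈ˢ Subgraph.V (H i)))
      ⊎ (∃[ u ] ∃[ v ] (u ∈ˢ Subgraph.V (H j) × v ∈ˢ Subgraph.V (H i) × u ∼ v))
    touch any with find any
    ... | v , v∈i , v∈N with find (∈-concatMap⁻ (λ u → u ∷ gs u) {xs = hs j} v∈N)
    -- The head of `u ∷ gs u` yields a common vertex, the tail a joining edge.
    ...   | u , u∈j , here refl = inj₁ (u , hs⁻ u∈j , hs⁻ v∈i)
    ...   | u , u∈j , there v∈  = inj₂ (u , v , hs⁻ u∈j , hs⁻ v∈i , Listing.sound (g u) v∈)
    any : (∃[ v ] (v ∈ˢ Subgraph.V (H j) × v ∈ˢ Subgraph.V (H i)))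
      ⊎ (∃[ u ] ∃[ v ] (u ∈ˢ Subgraph.V (H j) × v ∈ˢ Subgraph.V (H i) × u ∼ v)) →
      Any (_∈ closedNbhds gs xs hs j) (hs i)
    any (inj₁ (v , v∈j , v∈i)) = lose (hs⁺ v∈i) (∈-concatMap⁺ (λ u → u ∷ gs u) (lose (hs⁺ v∈j) (here refl)))
    any (inj₂ (u , v , u∈j , v∈i , e)) =
      lose (hs⁺ v∈i) (∈-concatMap⁺ (λ u → u ∷ gs u) (lose (hs⁺ u∈j) (there (Listing.complete (g u) e))))

  -- For bags the guard of `scan` is one plus the distance of row and index, so no index is skipped;
  -- `d` stands for that distance.
  meets-bag : ∀ t i d → (suc d ≢ 0 × Any (_∈ xs t) (hs i)) ⇔ (i ∈ˢ meetingBags H X t)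
  meets-bag t i d = mk⇔
    (λ (_ , any) → let v , v∈i , v∈t = find any in ∈-tabulate-does⁺ (meets? H X t) (v , hs⁻ v∈i , Listing.sound (x t) v∈t))
    (λ i∈ → let v , v∈i , v∈t = ∈-tabulate-does⁻ (meets? H X t) i∈ in (λ ()) , lose (hs⁺ v∈i) (Listing.complete (x t) v∈t))

  g′ : AdjacencyLists (G ⟨ H ⟩)
  g′ j = filterListing (j ≈?_)

  x′ : BagLists (meetingBags H X)
  x′ t = filterListing (_∈? meetingBags H X t)

  Output : State → Set
  Output σ = Stores σ GH-offset GH-nbr (rows g′) × Stores σ T-offset T-nbr (rows t) × Stores σ X′-offset X′-elem (rows x′)

  input-T : Stores σ₀ T-offset T-nbr (rows t)
  input-T = span⇒Holds (span-array (offsets 0 (rows t))) , span⇒Holds (span-array (concat (rows t)))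

  run-program : Run program σ₀ (118 * (1 + k * ((k + p) * n + ∣E∣ G))) Output
  run-program with k ≟ⁿ 0
  ... | yes k≡0 = within (≤-trans (s≤s (s≤s (s≤s z≤n))) (*-monoʳ-≤ 118 (m≤m+n 1 _))) (run-ifnz {t = 1}
    (λ k≢0 → ⊥-elim (k≢0 k≡0))
    (λ _ → run-skip (stores-empty σ₀ GH-offset GH-nbr (elems ∘ g′) k≡0 (λ _ → refl) , input-T , stores-empty σ₀ X′-offset X′-elem (elems ∘ x′) k≡0 (λ _ → refl))))
  ... | no k≢0 = within (programTime-≤ n k p (∣E∣ G) (n≢0⇒n>0 k≢0) 1≤n) (run-ifnz
    (λ _ → run-seq
      (run-outputRows gs xs hs 0 0 markClosedNbhd hs≤n (λ j l row= fresh → within (mark≤ j) (run-markClosedNbhd gs xs hs j l row= fresh))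
        -- All marks and the stamp are zero in the initial state, hence `z≤n`.
        _≈?_ meets-closedNbhds ((refl , array-table gs , array-table xs , array-table hs) , (λ _ → z≤n)) refl)
      λ {σ₁} u₁ (ready , GH) → combine u₁ GH
        (run-outputRows gs xs hs 2 1 markBag hs≤n
          (λ t l row= fresh → within (+-monoʳ-≤ 8 (loopTime-≤ 4 n (λ _ → ≤-refl) (xs t) (listing-length (x t)))) (run-markBag gs xs hs t l row= fresh))
          (λ t i → i ∈? meetingBags H X t) (λ t i → meets-bag t i _) ready (reg= u₁ ∣T∣)))
    (λ k≡0 → ⊥-elim (k≢0 k≡0)))
    where
    hs≤n : ∀ i → length (hs i) ≤ n
    hs≤n i = listing-length (SubgraphLists.vertices (h i))
    mark≤ : ∀ j → _ ≤ 12 + (26 * n + 24 * ∣E∣ G)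
    mark≤ j = markTime-≤ {l = n} {∣E∣ G} gs (hs j) (hs≤n j) (degree-sum {G = G} g (Listing.unique (SubgraphLists.vertices (h j))))
    1≤n : 1 ≤ n
    -- As `k` is positive there is a subgraph, and it has a vertex.
    1≤n = ≤-trans (s≤s z≤n) (toℕ<n (proj₁ (nonnull (fromℕ< (n≢0⇒n>0 k≢0)))))
    -- Frame information about the second run carries the first table and the tree over to the final
    -- state.
    combine : ∀ {σ₁ t} {R : State → Set} → Unchanged (outputRows 0 0 ∣J∣ markClosedNbhd) σ₀ σ₁ → Stores σ₁ GH-offset GH-nbr (rows g′) →
      Run (outputRows 2 1 ∣T∣ markBag) σ₁ t (λ σ → R σ × Stores σ X′-offset X′-elem (rows x′)) →
      Run (outputRows 2 1 ∣T∣ markBag) σ₁ t Output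
    combine u₁ GH (σ₂ , τ , run , τ≤t , _ , X′) = σ₂ , τ , run , τ≤t ,
      stores-kept GH-offset GH-nbr (rows g′) u₂ GH , stores-kept T-offset T-nbr (rows t) u₂ (stores-kept T-offset T-nbr (rows t) u₁ input-T) , X′
      where
      u₂ = unchanged run

corollary6p4 : Σ[ prog ∈ Cmd ] Σ[ C ∈ ℕ ]
    (∀ {n k p} (G : Graph n) (H : Fin k → Subgraph G) (T : Graph p) (X : Fin p → Subset n) →
    (∀ j → Connected (H j)) →
    (∀ j → Nonempty (Subgraph.V (H j))) →
    IsTreeDecomposition G T X →
    (g : AdjacencyLists G) (h : ∀ j → SubgraphLists (H j)) (t : AdjacencyLists T) (x : BagLists X) →
    ∃[ σ ] ∃[ τ ]
    ( ⟨ prog , input G H T X g h t x ⟩⇓⟨ σ , τ ⟩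
    × τ ≤ C * (1 + k * ((k + p) * n + ∣E∣ G))
    × (Σ[ g′ ∈ AdjacencyLists (G ⟨ H ⟩) ] Stores σ GH-offset GH-nbr (rows g′))
    × (Σ[ X′ ∈ (Fin p → Subset k) ]
    ( IsTreeDecomposition (G ⟨ H ⟩) T X′
    × Stores σ T-offset T-nbr (rows t)
    × (Σ[ x′ ∈ BagLists X′ ] Stores σ X′-offset X′-elem (rows x′))
    × α-bags (G ⟨ H ⟩) X′ ≤ α-bags G X))))
corollary6p4 = program , 118 , λ G H T X conn nonnull td g h t x →
  let σ , τ , run , τ≤ , GH , T-kept , X′ = run-program G H T X nonnull g h t x
  in σ , τ , run , τ≤ , (g′ G H T X nonnull g h t x , GH) ,
     meetingBags H X , meetingBags-treeDecomposition H X conn nonnull td , T-kept , (x′ G H T X nonnull g h t x , X′) ,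
     α-bags-meetingBags H X
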